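{- Let $Q$ be a weak primary pseudoperfect number such that the set $\mathfrak{N}_Q=\{n\in\mathbb{N}: S_{Qn}(Qn)\equiv n\pmod{Qn}\}$ is non-empty. Then $\mathfrak{N}_Q$ has strictly positive asymptotic density.
   Context: $\mathbb{N}=\{1,2,3,\dots\}$. For positive integers $m,k$, $S_m(k):=1^m+2^m+\cdots+k^m$. A positive integer $Q$ is a weak primary pseudoperfect number if $\sum_{p\mid Q}\frac{Q}{p}+1\equiv 0\pmod{Q}$, the sum over primes $p$ dividing $Q$ (so $Q=1$ qualifies). The asymptotic density of a set $A\subseteq\mathbb{N}$ is $\lim_{N\to\infty}\frac{\#(A\cap[1,N])}{N}$ when this limit exists. -}

module Defs where

open import Data.Nat using (ℕ; zero; suc; _+_; _*_; _^_; _≤_)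
open import Data.Nat.DivMod using (_/_)
open import Data.Nat.Divisibility as ℕD using ()
open import Data.Nat.Primality using (Prime; prime?)
open import Data.Integer as ℤ using (ℤ; +_)
open import Data.Integer.Divisibility using (_∣_)
open import Data.Rational as ℚ using (ℚ; 0ℚ)
open import Data.Product using (_×_; ∃; ∃-syntax)
open import Relation.Nullary using (Dec; yes; no; _×-dec_)

infix 4 _≡_[mod_]
_≡_[mod_] : ℕ → ℕ → ℕ → Set
a ≡ b [mod m ] = (+ m) ∣ ((+ a) ℤ.- (+ b))

_≡?_[mod_] : ∀ a b m → Dec (a ≡ b [mod m ])
a ≡? b [mod m ] = m ℕD.∣? ℤ.∣ (+ a) ℤ.- (+ b) ∣

S : ℕ → ℕ → ℕ
S m zero = 0
S m (suc k) = S m k + suc k ^ m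

primeQuotSum : ℕ → ℕ → ℕ
primeQuotSum Q zero = 0
primeQuotSum Q (suc k) with (prime? (suc k)) ×-dec (suc k ℕD.∣? Q)
... | yes _ = primeQuotSum Q k + Q / suc k
... | no _  = primeQuotSum Q k

-- Σ_{p prime, p ∣ Q} Q/p   (all prime divisors of Q ≥ 1 lie in [1, Q])
sumQoverP : ℕ → ℕ
sumQoverP Q = primeQuotSum Q Q

WeakPPN : ℕ → Set
WeakPPN Q = 1 ≤ Q × (sumQoverP Q + 1 ≡ 0 [mod Q ])

-- membership in 𝔑_Q : n ∈ ℕ = {1,2,...} and S_{Qn}(Qn) ≡ n (mod Qn)
InN : ℕ → ℕ → Set
InN Q n = 1 ≤ n × (S (Q * n) (Q * n) ≡ n [mod Q * n ])

InN? : ∀ Q n → Dec (InN Q n)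
InN? Q n = (1 Data.Nat.≤? n) ×-dec (S (Q * n) (Q * n) ≡? n [mod Q * n ])
  where import Data.Nat

count : {P : ℕ → Set} → (∀ n → Dec (P n)) → ℕ → ℕ
count P? zero = 0
count P? (suc N) with P? (suc N)
... | yes _ = suc (count P? N)
... | no _  = count P? N

ratio : {P : ℕ → Set} → (∀ n → Dec (P n)) → ℕ → ℚ
ratio P? N = (+ count P? (suc N)) ℚ./ suc N

-- the asymptotic density of A exists and is strictly positive:
-- the ratio sequence is Cauchy (so converges in ℝ) and is eventually
-- bounded below by a fixed positive rational (so the limit is > 0).
HasPositiveDensity : {P : ℕ → Set} → (∀ n → Dec (P n)) → Set
HasPositiveDensity P? =
  (∀ (ε : ℚ) → 0ℚ ℚ.< ε → ∃[ M ] ∀ m n → M ≤ m → M ≤ n →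
      ℚ.∣ ratio P? m ℚ.- ratio P? n ∣ ℚ.< ε)
  × (∃[ δ ] (0ℚ ℚ.< δ × ∃[ M ] ∀ n → M ≤ n → δ ℚ.≤ ratio P? n))

{-# OPTIONS --safe #-}
module Submission where

-- Write K = Q n.  For a prime power q ^ a exactly dividing K, the sum S_K(K) is congruent modulo q ^ a
-- to - K / q if q - 1 ∣ K and to 0 otherwise, while the congruence defining Q makes n congruent to
-- - K / q if q ∣ Q and to 0 otherwise.  Hence n ∈ 𝔑_Q iff for every prime q: q ∣ Q ⇔ q ∣ K and q - 1 ∣ K.
-- Restricting this to primes q ≤ T gives a periodic set.  A prime q > T ≥ Q excludes n only if
-- q (q - 1) ∣ Q n, so these primes exclude at most Q N / T of the n ≤ N, by telescoping; hence the density exists.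
-- For positivity take n₀ ∈ 𝔑_Q and the progression n₀ (M j + 1) with M = T !.  Primes up to T exclude none
-- of it, and because M j + 1 is prime to M the other primes exclude less than a fixed proportion of it.

import Algebra.Properties.CommutativeMonoid.Sum as MonoidSum
open import Data.Empty using (⊥; ⊥-elim)
open import Data.Fin as Fin using (Fin; toℕ; fromℕ<)
import Data.Fin.Properties as FinP
open import Data.Fin.Permutation using (Permutation; permutation)
open import Data.Integer as ℤ using (ℤ; +_)
import Data.Integer.Divisibility.Signed as ℤD
import Data.Integer.Properties as ℤP
import Data.Integer.Tactic.RingSolver as ℤSolver
open import Data.List using ([]; _∷_)
open import Data.List.Relation.Unary.All using (_∷_)
open import Data.Nat
open import Data.Nat.Coprimality as Coprime using (Coprime; coprime-divisor; coprime-Bézout)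
open import Data.Nat.DivMod
open import Data.Nat.Divisibility as ℕD using (_∣_; _∤_; divides)
open import Data.Nat.GCD using (module Bézout)
open import Data.Nat.Induction using (<-rec)
open import Data.Nat.Primality using (Prime; prime?; prime⇒nonZero; prime⇒nonTrivial; euclidsLemma; prime⇒irreducible)
open import Data.Nat.Primality.Factorisation using (factorise)
open import Data.Nat.Properties
open import Data.Nat.Tactic.RingSolver using (solve-∀)
open import Data.Product
open import Data.Rational as ℚ using (ℚ; 0ℚ; mkℚ)
import Data.Rational.Properties as ℚP
open import Data.Rational.Unnormalised as ℚᵘ using (ℚᵘ; mkℚᵘ)
import Data.Rational.Unnormalised.Properties as ℚᵘP
open import Data.Sum as Sum using (_⊎_; inj₁; inj₂)
open import Data.Unit using (⊤; tt)
open import Defs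
open import Function using (_∘_)
open import Relation.Binary.PropositionalEquality hiding (J)
open import Relation.Nullary
open import Relation.Nullary.Decidable using (_→-dec_)

-- Two obstacles shape the proof. The vanishing of a power sum modulo `q ^ a` is usually shown with
-- a primitive root. One unit g with g ^ K ≢ 1 modulo q is enough, since multiplication by g
-- permutes the residues and so (g ^ K - 1) times the sum vanishes. Finite differences supply g: if
-- x ^ r ≡ 1 held for all units with 1 ≤ r < q - 1, then q would divide the r-th difference r !. The
-- other obstacle is positivity. The bound Q N / T on the excluded n is useless by itself, because
-- the periodic set is only known to contain a progression of density 1 / (n₀ T !), far below Q / T.
-- Inside the progression, if q (q - 1) divides both Q n₀ (M i + 1) and Q n₀ (M j + 1), it divides Q
-- n₀ (j - i), without the factor M. The excluded indices are thus spaced as if M were absent, and T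
-- can be chosen as a multiple of Q n₀ before M is known. The price is one extra index per prime, so
-- this estimate is used for boundedly many primes only and a cruder one beyond them.

-- Congruences

-- A record, because a, b and m cannot be inferred from the unfolded type a ≡ b [mod m ].
infix 4 _≡_⟨mod_⟩
record _≡_⟨mod_⟩ (a b m : ℕ) : Set where
  constructor mk
  field difference : + m ℤD.∣ + a ℤ.- + b

open _≡_⟨mod_⟩

private variable a b c d m n p q : ℕ

toMod : a ≡ b ⟨mod m ⟩ → a ≡ b [mod m ]
toMod (mk d) = ℤD.∣⇒∣ᵤ d

fromMod : ∀ a b m → a ≡ b [mod m ] → a ≡ b ⟨mod m ⟩
fromMod a b m d = mk (ℤD.∣ᵤ⇒∣ {+ m} {+ a ℤ.- + b} d)

≡⇒mod : a ≡ b → a ≡ b ⟨mod m ⟩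
≡⇒mod {a} {m = m} refl = mk (ℤD.divides (+ 0) (ℤP.i≡j⇒i-j≡0 {+ a} refl))

mod-sym : a ≡ b ⟨mod m ⟩ → b ≡ a ⟨mod m ⟩
mod-sym {a} {b} (mk d) = mk (subst (_ ℤD.∣_) (neg-diff (+ a) (+ b)) (ℤD.∣m⇒∣-m d))
  where
  neg-diff : ∀ x y → ℤ.- (x ℤ.- y) ≡ y ℤ.- x
  neg-diff = ℤSolver.solve-∀

mod-trans : a ≡ b ⟨mod m ⟩ → b ≡ c ⟨mod m ⟩ → a ≡ c ⟨mod m ⟩
mod-trans {a} {b} {c = c} (mk d) (mk e) =
  mk (subst (_ ℤD.∣_) (add-diff (+ a) (+ b) (+ c)) (ℤD.∣m∣n⇒∣m+n d e))
  where
  add-diff : ∀ x y z → (x ℤ.- y) ℤ.+ (y ℤ.- z) ≡ x ℤ.- z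
  add-diff = ℤSolver.solve-∀

mod-+ : a ≡ b ⟨mod m ⟩ → c ≡ d ⟨mod m ⟩ → a + c ≡ b + d ⟨mod m ⟩
mod-+ {a} {b} {m} {c} {d} (mk p) (mk q) =
  mk (subst (_ ℤD.∣_) eq (ℤD.∣m∣n⇒∣m+n p q))
  where
  lemma : ∀ x y z w → (x ℤ.- y) ℤ.+ (z ℤ.- w) ≡ (x ℤ.+ z) ℤ.- (y ℤ.+ w)
  lemma = ℤSolver.solve-∀
  eq : (+ a ℤ.- + b) ℤ.+ (+ c ℤ.- + d) ≡ + (a + c) ℤ.- + (b + d)
  eq = trans (lemma (+ a) (+ b) (+ c) (+ d))
             (cong₂ ℤ._-_ (sym (ℤP.pos-+ a c)) (sym (ℤP.pos-+ b d)))

mod-* : a ≡ b ⟨mod m ⟩ → c ≡ d ⟨mod m ⟩ → a * c ≡ b * d ⟨mod m ⟩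
mod-* {a} {b} {m} {c} {d} (mk p) (mk q) =
  mk (subst (_ ℤD.∣_) eq (ℤD.∣m∣n⇒∣m+n (ℤD.∣m⇒∣m*n (+ c) p) (ℤD.∣n⇒∣m*n (+ b) q)))
  where
  lemma : ∀ x y z w → (x ℤ.- y) ℤ.* z ℤ.+ y ℤ.* (z ℤ.- w) ≡ x ℤ.* z ℤ.- y ℤ.* w
  lemma = ℤSolver.solve-∀
  eq : (+ a ℤ.- + b) ℤ.* + c ℤ.+ + b ℤ.* (+ c ℤ.- + d) ≡ + (a * c) ℤ.- + (b * d)
  eq = trans (lemma (+ a) (+ b) (+ c) (+ d))
             (cong₂ ℤ._-_ (sym (ℤP.pos-* a c)) (sym (ℤP.pos-* b d)))

mod-^ : ∀ k → a ≡ b ⟨mod m ⟩ → a ^ k ≡ b ^ k ⟨mod m ⟩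
mod-^ zero    _ = ≡⇒mod refl
mod-^ (suc k) e = mod-* e (mod-^ k e)

∣⇒mod0 : m ∣ a → a ≡ 0 ⟨mod m ⟩
∣⇒mod0 {m} {a} m∣a = fromMod a 0 m (subst (m ∣_) (cong ℤ.∣_∣ (sym (ℤP.+-identityʳ (+ a)))) m∣a)

mod0⇒∣ : a ≡ 0 ⟨mod m ⟩ → m ∣ a
mod0⇒∣ {a} {m} e = subst (m ∣_) (cong ℤ.∣_∣ (ℤP.+-identityʳ (+ a))) (toMod e)

%-mod : ∀ a m .{{_ : NonZero m}} → a % m ≡ a ⟨mod m ⟩
%-mod a m = mod-trans (≡⇒mod (sym (+-identityʳ _)))
  (mod-trans (mod-+ (≡⇒mod refl) (mod-sym (∣⇒mod0 (ℕD.n∣m*n (a / m)))))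
             (≡⇒mod (sym (m≡m%n+[m/n]*n a m))))

mod-∣ : m ∣ n → a ≡ b ⟨mod n ⟩ → a ≡ b ⟨mod m ⟩
mod-∣ m∣n (mk d) = mk (ℤD.∣-trans (ℤD.∣ᵤ⇒∣ m∣n) d)

mod⇒%≡ : .{{_ : NonZero m}} → a ≡ b ⟨mod m ⟩ → a % m ≡ b % m
mod⇒%≡ {m} {a} {b} (mk (ℤD.divides k eq)) with k
... | + j = trans (cong (_% m) a≡b+jm) ([m+kn]%n≡m%n b j m)
  where
  lemma : ∀ x y z → x ℤ.- y ≡ z → x ≡ y ℤ.+ z
  lemma x y z refl = sym (solve′ x y)
    where
    solve′ : ∀ x y → y ℤ.+ (x ℤ.- y) ≡ x
    solve′ = ℤSolver.solve-∀
  a≡b+jm : a ≡ b + j * m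
  a≡b+jm = ℤP.+-injective (trans (lemma (+ a) (+ b) _ (trans eq (sym (ℤP.pos-* j m)))) (sym (ℤP.pos-+ b (j * m))))
... | ℤ.-[1+ j ] = sym (trans (cong (_% m) b≡a+jm) ([m+kn]%n≡m%n a (suc j) m))
  where
  lemma : ∀ x y z w → x ℤ.- y ≡ (ℤ.- z) ℤ.* w → y ≡ x ℤ.+ z ℤ.* w
  lemma x y z w e = trans (solve′ x y) (trans (cong (λ t → x ℤ.- t) e) (solve″ x z w))
    where
    solve′ : ∀ x y → y ≡ x ℤ.- (x ℤ.- y)
    solve′ = ℤSolver.solve-∀
    solve″ : ∀ x z w → x ℤ.- ((ℤ.- z) ℤ.* w) ≡ x ℤ.+ z ℤ.* w
    solve″ = ℤSolver.solve-∀
  b≡a+jm : b ≡ a + suc j * m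
  b≡a+jm = ℤP.+-injective (trans (lemma (+ a) (+ b) (+ suc j) (+ m) eq)
    (trans (cong (λ t → + a ℤ.+ t) (sym (ℤP.pos-* (suc j) m))) (sym (ℤP.pos-+ a (suc j * m)))))

mod-*-cancelˡ : ∀ c → Coprime m c → c * a ≡ c * b ⟨mod m ⟩ → a ≡ b ⟨mod m ⟩
mod-*-cancelˡ {m} {a} {b} c cop e =
  fromMod a b m (coprime-divisor cop (subst (m ∣_) eq (toMod e)))
  where
  lemma : ∀ x y z → x ℤ.* y ℤ.- x ℤ.* z ≡ x ℤ.* (y ℤ.- z)
  lemma = ℤSolver.solve-∀
  eq : ℤ.∣ + (c * a) ℤ.- + (c * b) ∣ ≡ c * ℤ.∣ + a ℤ.- + b ∣
  eq = trans (cong ℤ.∣_∣ (trans (cong₂ ℤ._-_ (ℤP.pos-* c a) (ℤP.pos-* c b)) (lemma (+ c) (+ a) (+ b))))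
             (ℤP.abs-* (+ c) (+ a ℤ.- + b))

mod-+-cancelʳ : ∀ c → a + c ≡ b + c ⟨mod m ⟩ → a ≡ b ⟨mod m ⟩
mod-+-cancelʳ {a} {b} {m} c (mk d) = mk (subst (+ m ℤD.∣_) eq d)
  where
  lemma : ∀ x y z → (x ℤ.+ z) ℤ.- (y ℤ.+ z) ≡ x ℤ.- y
  lemma = ℤSolver.solve-∀
  eq : + (a + c) ℤ.- + (b + c) ≡ + a ℤ.- + b
  eq = trans (cong₂ ℤ._-_ (ℤP.pos-+ a c) (ℤP.pos-+ b c)) (lemma (+ a) (+ b) (+ c))

module ModReasoning (m : ℕ) where
  infix  1 begin_
  infixr 2 step-mod
  infix  3 _∎
  begin_ : a ≡ b ⟨mod m ⟩ → a ≡ b ⟨mod m ⟩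
  begin e = e
  step-mod : ∀ a → b ≡ c ⟨mod m ⟩ → a ≡ b ⟨mod m ⟩ → a ≡ c ⟨mod m ⟩
  step-mod a e d = mod-trans d e
  _∎ : ∀ a → a ≡ a ⟨mod m ⟩
  a ∎ = ≡⇒mod refl
  syntax step-mod a e d = a ≈⟨ d ⟩ e

-- Permutations of residues and Fermat's theorem

prime∤⇒coprime : Prime p → p ∤ a → Coprime p a
prime∤⇒coprime pr p∤a {d} (d∣p , d∣a) with prime⇒irreducible pr d∣p
... | inj₁ d≡1 = d≡1
... | inj₂ refl = ⊥-elim (p∤a d∣a)

coprime-* : Coprime a c → Coprime b c → Coprime (a * b) c
coprime-* {a} {c} ac bc {d} (d∣ab , d∣c) =
  bc (coprime-divisor (λ (e∣d , e∣a) → ac (e∣a , ℕD.∣-trans e∣d d∣c)) d∣ab , d∣c)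

coprime-^ : ∀ k → Coprime a c → Coprime (a ^ k) c
coprime-^ zero    _ (d∣1 , _) = ℕD.∣1⇒≡1 d∣1
coprime-^ {a} (suc k) ac = coprime-* {a} ac (coprime-^ k ac)

prime>1 : Prime p → 1 < p
prime>1 {p} pr = nonTrivial⇒n>1 p {{prime⇒nonTrivial pr}}

drop-multiple-mod : a + b ≡ c → m ∣ b → a ≡ c ⟨mod m ⟩
drop-multiple-mod {a} e m∣b = mod-trans (≡⇒mod (sym (+-identityʳ a)))
  (mod-trans (mod-+ (≡⇒mod refl) (mod-sym (∣⇒mod0 m∣b))) (≡⇒mod e))

modInverse : ∀ g n → Coprime g n → ∃[ h ] h * g ≡ 1 ⟨mod n ⟩
modInverse g n cop with coprime-Bézout cop
... | Bézout.+- x y eq = x , mod-sym (drop-multiple-mod eq (ℕD.n∣m*n y))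
-- Here `x * g` is -1 modulo `n`, so its square is 1 and `x * (x * g)` is an inverse without
-- negative numbers.
... | Bézout.-+ x y eq = x * x * g , (begin
    x * x * g * g ≈⟨ ≡⇒mod (lemma x g) ⟩
    x * g * (x * g) ≈⟨ mod-+-cancelʳ (x * g) (begin
        x * g * (x * g) + x * g ≈⟨ ≡⇒mod (trans (lemma₂ x g) (trans (cong (x * g *_) eq) (sym (*-assoc (x * g) y n)))) ⟩
        x * g * y * n ≈⟨ ∣⇒mod0 (ℕD.n∣m*n (x * g * y)) ⟩
        0 ≈⟨ mod-sym (∣⇒mod0 (ℕD.n∣m*n y)) ⟩
        y * n ≈⟨ ≡⇒mod (sym eq) ⟩
        1 + x * g ∎) ⟩
    1 ∎)
  where
  open ModReasoning n
  lemma : ∀ x g → x * x * g * g ≡ x * g * (x * g)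
  lemma = solve-∀
  lemma₂ : ∀ x g → x * g * (x * g) + x * g ≡ x * g * (1 + x * g)
  lemma₂ = solve-∀

module _ {n} .{{_ : NonZero n}} where
  abstract
    scale : ℕ → Fin n → Fin n
    scale g i = (g * toℕ i) mod n

    toℕ-scale : ∀ g i → toℕ (scale g i) ≡ (g * toℕ i) % n
    toℕ-scale g i = FinP.toℕ-fromℕ< (m%n<n (g * toℕ i) n)

  scale-inverse : ∀ g h → h * g ≡ 1 ⟨mod n ⟩ → ∀ i → scale h (scale g i) ≡ i
  scale-inverse g h hg≡1 i = FinP.toℕ-injective (begin-equality
    toℕ (scale h (scale g i))         ≡⟨ toℕ-scale h _ ⟩
    (h * toℕ (scale g i)) % n         ≡⟨ mod⇒%≡ step ⟩
    toℕ i % n                         ≡⟨ m<n⇒m%n≡m (FinP.toℕ<n i) ⟩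
    toℕ i                             ∎)
    where
    open ≤-Reasoning
    step : h * toℕ (scale g i) ≡ toℕ i ⟨mod n ⟩
    step = mod-trans (mod-* {a = h} (≡⇒mod refl) (mod-trans (≡⇒mod (toℕ-scale g i)) (%-mod (g * toℕ i) n)))
      (mod-trans (≡⇒mod (sym (*-assoc h g _)))
      (mod-trans (mod-* hg≡1 (≡⇒mod refl)) (≡⇒mod (*-identityˡ (toℕ i)))))

  scalePermutation : ∀ g → Coprime g n → Permutation n n
  scalePermutation g cop =
    let h , hg≡1 = modInverse g n cop
    in permutation (scale g) (scale h)
         (scale-inverse h g (mod-trans (≡⇒mod (*-comm g h)) hg≡1))
         (scale-inverse g h hg≡1)

open MonoidSum +-0-commutativeMonoid using (sum; sum-permute)
module Π = MonoidSum *-1-commutativeMonoid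

module _ {n} .{{_ : NonZero n}} (g : ℕ) (cop : Coprime g n) (f : Fin n → ℕ) where
  sum-permute-scale : sum f ≡ sum (λ i → f (scale g i))
  sum-permute-scale = sum-permute f (scalePermutation g cop)

  product-permute-scale : Π.sum f ≡ Π.sum (λ i → f (scale g i))
  product-permute-scale = Π.sum-permute f (scalePermutation g cop)

sum-mod-cong : ∀ {n} {f g : Fin n → ℕ} → (∀ i → f i ≡ g i ⟨mod m ⟩) → sum f ≡ sum g ⟨mod m ⟩
sum-mod-cong {n = zero}  e = ≡⇒mod refl
sum-mod-cong {n = suc n} e = mod-+ (e Fin.zero) (sum-mod-cong (e ∘ Fin.suc))

product-mod-cong : ∀ {n} {f g : Fin n → ℕ} → (∀ i → f i ≡ g i ⟨mod m ⟩) → Π.sum f ≡ Π.sum g ⟨mod m ⟩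
product-mod-cong {n = zero}  e = ≡⇒mod refl
product-mod-cong {n = suc n} e = mod-* (e Fin.zero) (product-mod-cong (e ∘ Fin.suc))

product-scale : ∀ {n} g (f : Fin n → ℕ) → Π.sum (λ i → g * f i) ≡ g ^ n * Π.sum f
product-scale {zero}  g f = refl
product-scale {suc n} g f =
  trans (cong (g * f Fin.zero *_) (product-scale g (f ∘ Fin.suc))) (lemma g (g ^ n) (f Fin.zero) _)
  where
  lemma : ∀ a b c d → a * c * (b * d) ≡ a * b * (c * d)
  lemma = solve-∀

sum-scale : ∀ {n} g (f : Fin n → ℕ) → sum (λ i → g * f i) ≡ g * sum f
sum-scale {zero}  g f = sym (*-zeroʳ g)
sum-scale {suc n} g f =
  trans (cong (λ t → g * f Fin.zero + t) (sum-scale g (f ∘ Fin.suc))) (sym (*-distribˡ-+ g _ _))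

prime∤product : ∀ {n} (f : Fin n → ℕ) → Prime p → (∀ i → p ∤ f i) → p ∤ Π.sum f
prime∤product {n = zero}  f pr p∤f p∣1 = <⇒≢ (prime>1 pr) (sym (ℕD.∣1⇒≡1 p∣1))
prime∤product {n = suc n} f pr p∤f p∣fΠ with euclidsLemma (f Fin.zero) _ pr p∣fΠ
... | inj₁ p∣f0 = p∤f Fin.zero p∣f0
... | inj₂ p∣Π  = prime∤product (f ∘ Fin.suc) pr (p∤f ∘ Fin.suc) p∣Π

-- The value 1 replaces the residue 0, so that the product over all residues is a unit.
nonzeroPart : ℕ → ℕ
nonzeroPart zero    = 1
nonzeroPart (suc x) = suc x

nonzeroPart-∤ : p ∤ a → nonzeroPart a ≡ a
nonzeroPart-∤ {a = zero}  p∤0 = ⊥-elim (p∤0 (_ ℕD.∣0))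
nonzeroPart-∤ {a = suc a} _   = refl

-- Multiplication by `g` permutes the residues and fixes 0, so the product `P` of the nonzero ones
-- satisfies P ≡ g ^ (p - 1) P, and `P` is prime to `p`.
fermat : ∀ g → Prime p → p ∤ g → g ^ (p ∸ 1) ≡ 1 ⟨mod p ⟩
fermat {p@(suc r)} g pr p∤g = mod-*-cancelˡ P (prime∤⇒coprime pr p∤P)
    (mod-trans (≡⇒mod (*-comm P _)) (mod-trans (mod-sym P≡gʳP) (≡⇒mod (sym (*-identityʳ P)))))
  where
  units : Fin r → ℕ
  units i = suc (toℕ i)
  p∤units : ∀ i → p ∤ units i
  p∤units i = ℕD.>⇒∤ (s≤s (FinP.toℕ<n i))
  P = Π.sum units
  p∤P : p ∤ P
  p∤P = prime∤product units pr p∤units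
  scaled : ∀ i → nonzeroPart (toℕ (scale g (Fin.suc i))) ≡ g * units i ⟨mod p ⟩
  scaled i = mod-trans (≡⇒mod (nonzeroPart-∤ p∤scaled)) step
    where
    step : toℕ (scale g (Fin.suc i)) ≡ g * units i ⟨mod p ⟩
    step = mod-trans (≡⇒mod (toℕ-scale g (Fin.suc i))) (%-mod (g * units i) p)
    p∤scaled : p ∤ toℕ (scale g (Fin.suc i))
    p∤scaled p∣ = Sum.[ p∤g , p∤units i ]′
      (euclidsLemma g (units i) pr (mod0⇒∣ (mod-trans (mod-sym step) (∣⇒mod0 p∣))))
  scaled₀ : nonzeroPart (toℕ (scale {p} g Fin.zero)) ≡ 1
  scaled₀ = cong nonzeroPart (trans (toℕ-scale g Fin.zero) (cong (_% p) (*-zeroʳ g)))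
  permuted : Π.sum (λ i → nonzeroPart (toℕ {p} i)) ≡ Π.sum (λ i → nonzeroPart (toℕ (scale {p} g i)))
  permuted = product-permute-scale g (Coprime.sym (prime∤⇒coprime pr p∤g)) (λ i → nonzeroPart (toℕ i))
  P≡gʳP : P ≡ g ^ r * P ⟨mod p ⟩
  P≡gʳP = begin
    P ≈⟨ ≡⇒mod (sym (*-identityˡ P)) ⟩
    1 * P ≈⟨ ≡⇒mod permuted ⟩
    nonzeroPart (toℕ (scale {p} g Fin.zero)) * Π.sum (λ i → nonzeroPart (toℕ (scale {p} g (Fin.suc i))))
      ≈⟨ mod-* (≡⇒mod scaled₀) (product-mod-cong scaled) ⟩
    1 * Π.sum (λ i → g * units i) ≈⟨ ≡⇒mod (trans (*-identityˡ _) (product-scale g units)) ⟩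
    g ^ r * P ∎
    where open ModReasoning p

-- Finite differences of powers

Δ : (ℕ → ℤ) → ℕ → ℤ
Δ f x = f (suc x) ℤ.- f x

Δ^ : ℕ → (ℕ → ℤ) → ℕ → ℤ
Δ^ zero    f = f
Δ^ (suc k) f = Δ^ k (Δ f)

Δ^-cong : ∀ k {f g} → (∀ x → f x ≡ g x) → ∀ x → Δ^ k f x ≡ Δ^ k g x
Δ^-cong zero    f≗g = f≗g
Δ^-cong (suc k) f≗g = Δ^-cong k (λ x → cong₂ ℤ._-_ (f≗g (suc x)) (f≗g x))

Δ^-shift : ∀ k f x → Δ^ k (f ∘ suc) x ≡ Δ^ k f (suc x)
Δ^-shift zero    f x = refl
Δ^-shift (suc k) f x = Δ^-shift k (Δ f) x

Δ^-+ : ∀ k f g x → Δ^ k (λ y → f y ℤ.+ g y) x ≡ Δ^ k f x ℤ.+ Δ^ k g x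
Δ^-+ zero    f g x = refl
Δ^-+ (suc k) f g x =
  trans (Δ^-cong k (λ y → lemma (f (suc y)) (g (suc y)) (f y) (g y)) x) (Δ^-+ k (Δ f) (Δ g) x)
  where
  lemma : ∀ a b c d → (a ℤ.+ b) ℤ.- (c ℤ.+ d) ≡ (a ℤ.- c) ℤ.+ (b ℤ.- d)
  lemma = ℤSolver.solve-∀

Δ^-suc : ∀ k f x → Δ^ (suc k) f x ≡ Δ (Δ^ k f) x
Δ^-suc zero    f x = refl
Δ^-suc (suc k) f x = Δ^-suc k (Δ f) x

Δ-leibniz : ∀ f x → Δ (λ y → + y ℤ.* f y) x ≡ + x ℤ.* Δ f x ℤ.+ f (suc x)
Δ-leibniz f x = lemma (+ x) (f (suc x)) (f x)
  where
  lemma : ∀ a b c → (+ 1 ℤ.+ a) ℤ.* b ℤ.- a ℤ.* c ≡ a ℤ.* (b ℤ.- c) ℤ.+ b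
  lemma = ℤSolver.solve-∀

-- The discrete Leibniz rule has only two terms here, because the second difference of the factor y
-- is 0.
Δ^-leibniz : ∀ k f x → Δ^ (suc k) (λ y → + y ℤ.* f y) x
                       ≡ + x ℤ.* Δ^ (suc k) f x ℤ.+ + suc k ℤ.* Δ^ k f (suc x)
Δ^-leibniz zero    f x = trans (Δ-leibniz f x) (cong (λ t → + x ℤ.* Δ f x ℤ.+ t) (sym (ℤP.*-identityˡ (f (suc x)))))
Δ^-leibniz (suc k) f x = begin
  Δ^ (suc k) (Δ (λ y → + y ℤ.* f y)) x
    ≡⟨ Δ^-cong (suc k) (Δ-leibniz f) x ⟩
  Δ^ (suc k) (λ y → + y ℤ.* Δ f y ℤ.+ f (suc y)) x
    ≡⟨ Δ^-+ (suc k) (λ y → + y ℤ.* Δ f y) (f ∘ suc) x ⟩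
  Δ^ (suc k) (λ y → + y ℤ.* Δ f y) x ℤ.+ Δ^ (suc k) (f ∘ suc) x
    ≡⟨ cong₂ ℤ._+_ (Δ^-leibniz k (Δ f) x) (Δ^-shift (suc k) f x) ⟩
  (+ x ℤ.* Δ^ (suc (suc k)) f x ℤ.+ + suc k ℤ.* Δ^ (suc k) f (suc x)) ℤ.+ Δ^ (suc k) f (suc x)
    ≡⟨ lemma (+ x ℤ.* Δ^ (suc (suc k)) f x) (+ suc k) (Δ^ (suc k) f (suc x)) ⟩
  + x ℤ.* Δ^ (suc (suc k)) f x ℤ.+ + suc (suc k) ℤ.* Δ^ (suc k) f (suc x) ∎
  where
  open ≡-Reasoning
  lemma : ∀ a b c → (a ℤ.+ b ℤ.* c) ℤ.+ c ≡ a ℤ.+ (+ 1 ℤ.+ b) ℤ.* c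
  lemma = ℤSolver.solve-∀

power : ℕ → ℕ → ℤ
power r x = + (x ^ r)

power-suc : ∀ r x → power (suc r) x ≡ + x ℤ.* power r x
power-suc r x = ℤP.pos-* x (x ^ r)

mutual
  Δ^-power : ∀ r x → Δ^ r (power r) x ≡ + (r !)
  Δ^-power zero    x = refl
  Δ^-power (suc r) x = begin
    Δ^ (suc r) (power (suc r)) x
      ≡⟨ Δ^-cong (suc r) (power-suc r) x ⟩
    Δ^ (suc r) (λ y → + y ℤ.* power r y) x
      ≡⟨ Δ^-leibniz r (power r) x ⟩
    + x ℤ.* Δ^ (suc r) (power r) x ℤ.+ + suc r ℤ.* Δ^ r (power r) (suc x)
      ≡⟨ cong₂ (λ s t → + x ℤ.* s ℤ.+ + suc r ℤ.* t) (Δ^-power-vanishes r x) (Δ^-power r (suc x)) ⟩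
    + x ℤ.* + 0 ℤ.+ + suc r ℤ.* + (r !)
      ≡⟨ cong₂ ℤ._+_ (ℤP.*-zeroʳ (+ x)) (sym (ℤP.pos-* (suc r) (r !))) ⟩
    + 0 ℤ.+ + (suc r * r !)
      ≡⟨ ℤP.+-identityˡ _ ⟩
    + (suc r * r !) ∎
    where open ≡-Reasoning

  Δ^-power-vanishes : ∀ r x → Δ^ (suc r) (power r) x ≡ + 0
  Δ^-power-vanishes r x = trans (Δ^-suc r (power r) x)
    (trans (cong₂ ℤ._-_ (Δ^-power r (suc x)) (Δ^-power r x)) (ℤP.+-inverseʳ (+ (r !))))

-- The k-th difference at x involves only the values at x, ..., k + x, all of which must stay below
-- `n`.
∣Δ^ : ∀ {d n} k f → (∀ x → 1 ≤ x → x < n → d ℤD.∣ f x) → ∀ x → 1 ≤ x → k + x < n → d ℤD.∣ Δ^ k f x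
∣Δ^ zero    f d∣f x 1≤x x<n = d∣f x 1≤x x<n
∣Δ^ {d} {n} (suc k) f d∣f x 1≤x skx<n = subst (d ℤD.∣_) (sym (Δ^-suc k f x))
  (ℤD.∣m∣n⇒∣m-n (∣Δ^ k f d∣f (suc x) (s≤s z≤n) (subst (_< n) (sym (+-suc k x)) skx<n))
                (∣Δ^ k f d∣f x 1≤x (<-trans (n<1+n _) skx<n)))

prime∣!⇒≤ : ∀ n → Prime p → p ∣ n ! → p ≤ n
prime∣!⇒≤ zero    pr p∣1 = ⊥-elim (<⇒≢ (prime>1 pr) (sym (ℕD.∣1⇒≡1 p∣1)))
prime∣!⇒≤ (suc n) pr p∣ = Sum.[ ℕD.∣⇒≤ , m≤n⇒m≤1+n ∘ prime∣!⇒≤ n pr ]′ (euclidsLemma (suc n) (n !) pr p∣)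

-- If x ^ r ≡ 1 for all units x, then p divides the r-th difference r ! of x ^ r.
¬allUnitsRoots : ∀ r → Prime p → 1 ≤ r → suc r < p → ¬ (∀ x → 1 ≤ x → x < p → x ^ r ≡ 1 ⟨mod p ⟩)
¬allUnitsRoots {p} (suc r) pr _ ssr<p roots = <⇒≱ (<-trans (n<1+n _) ssr<p)
  (prime∣!⇒≤ (suc r) pr (ℤD.∣⇒∣ᵤ (subst (+ p ℤD.∣_) (Δ^-power (suc r) 1)
    (∣Δ^ r (Δ (power (suc r))) p∣Δ 1 ≤-refl (subst (_< pred p) (+-comm 1 r) (pred-mono-< ssr<p))))))
  where
  -- Passing to the first difference removes the constant 1. Both x and x + 1 must be units, whence
  -- the bound `pred p`.
  p∣Δ : ∀ x → 1 ≤ x → x < pred p → + p ℤD.∣ Δ (power (suc r)) x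
  p∣Δ x 1≤x x<p-1 = difference
    (mod-trans (roots (suc x) (s≤s z≤n) (subst (suc x <_) (suc-pred p {{prime⇒nonZero pr}}) (s≤s x<p-1)))
               (mod-sym (roots x 1≤x (<-≤-trans x<p-1 pred[n]≤n))))

-- Being a root is decidable and the units are finitely many, so the failure of the universal
-- statement yields a witness. This replaces a primitive root.
nonRoot : ∀ r → Prime p → 1 ≤ r → suc r < p → ∃[ g ] p ∤ g × ¬ (g ^ r ≡ 1 ⟨mod p ⟩)
nonRoot {p} r pr 1≤r sr<p =
  let i , ¬root = FinP.¬∀⟶∃¬ (pred p) Root root? ¬roots
  in unit i , ℕD.>⇒∤ (unit<p i) , ¬root ∘ toMod
  where
  unit : Fin (pred p) → ℕ
  unit i = suc (toℕ i)
  unit<p : ∀ i → unit i < p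
  unit<p i = subst (unit i <_) (suc-pred p {{prime⇒nonZero pr}}) (s≤s (FinP.toℕ<n i))
  Root : Fin (pred p) → Set
  Root i = unit i ^ r ≡ 1 [mod p ]
  root? : ∀ i → Dec (Root i)
  root? i = (unit i ^ r) ≡? 1 [mod p ]
  ¬roots : ¬ (∀ i → Root i)
  ¬roots roots = ¬allUnitsRoots r pr 1≤r sr<p λ where
    (suc x) _ x<p → subst (λ y → suc y ^ r ≡ 1 ⟨mod p ⟩) (FinP.toℕ-fromℕ< (pred-mono-< x<p))
                      (fromMod (unit (fromℕ< (pred-mono-< x<p)) ^ r) 1 p (roots (fromℕ< (pred-mono-< x<p))))

-- Fermat reduces the exponent modulo p - 1. The remainder is positive because p - 1 ∤ K, and it is
-- small enough for `nonRoot`.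
nonRoot-∤ : ∀ K → Prime p → p ∸ 1 ∤ K → ∃[ g ] p ∤ g × ¬ (g ^ K ≡ 1 ⟨mod p ⟩)
nonRoot-∤ {p@(suc zero)} K pr _ = ⊥-elim (<⇒≢ (prime>1 pr) refl)
nonRoot-∤ {p@(suc u@(suc _))} K pr p-1∤K =
  let g , p∤g , ¬root = nonRoot (K % u) pr (n≢0⇒n>0 (λ r≡0 → p-1∤K (ℕD.m%n≡0⇒n∣m K u r≡0))) (s≤s (m%n<n K u))
  in g , p∤g , λ gᴷ≡1 → ¬root (mod-trans (mod-sym (reduce g p∤g)) gᴷ≡1)
  where
  reduce : ∀ g → p ∤ g → g ^ K ≡ g ^ (K % u) ⟨mod p ⟩
  reduce g p∤g = begin
    g ^ K                               ≈⟨ ≡⇒mod (cong (g ^_) (m≡m%n+[m/n]*n K u)) ⟩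
    g ^ (K % u + K / u * u)             ≈⟨ ≡⇒mod (^-distribˡ-+-* g (K % u) (K / u * u)) ⟩
    g ^ (K % u) * g ^ (K / u * u)       ≈⟨ ≡⇒mod (cong (λ e → g ^ (K % u) * g ^ e) (*-comm (K / u) u)) ⟩
    g ^ (K % u) * g ^ (u * (K / u))     ≈⟨ ≡⇒mod (cong (g ^ (K % u) *_) (sym (^-*-assoc g u (K / u)))) ⟩
    g ^ (K % u) * (g ^ u) ^ (K / u)     ≈⟨ mod-* {a = g ^ (K % u)} (≡⇒mod refl) (mod-^ (K / u) (fermat g pr p∤g)) ⟩
    g ^ (K % u) * 1 ^ (K / u)           ≈⟨ ≡⇒mod (cong (g ^ (K % u) *_) (^-zeroˡ (K / u))) ⟩
    g ^ (K % u) * 1                     ≈⟨ ≡⇒mod (*-identityʳ _) ⟩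
    g ^ (K % u)                         ∎
    where open ModReasoning p

-- Power sums modulo prime powers

∣⇒^∣^ : ∀ {q x} a k → q ∣ x → a ≤ k → q ^ a ∣ x ^ k
∣⇒^∣^ zero    k       q∣x _         = ℕD.1∣ _
∣⇒^∣^ (suc a) (suc k) q∣x (s≤s a≤k) = ℕD.*-pres-∣ q∣x (∣⇒^∣^ a k q∣x a≤k)

-- The binomial theorem to first order; `s` collects all terms from the quadratic one on.
power-expansion : ∀ {y m t} k → + y ≡ + 1 ℤ.+ t ℤ.* + m →
  ∃[ s ] + (y ^ k) ≡ + 1 ℤ.+ + k ℤ.* t ℤ.* + m ℤ.+ s ℤ.* (+ m ℤ.* + m)
power-expansion {m = m} {t} zero y≡1+tm = + 0 , base t (+ m)
  where
  base : ∀ t m → + 1 ≡ + 1 ℤ.+ + 0 ℤ.* t ℤ.* m ℤ.+ + 0 ℤ.* (m ℤ.* m)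
  base = ℤSolver.solve-∀
power-expansion {y} {m} {t} (suc k) y≡1+tm =
  let s , eq = power-expansion {y} {m} {t} k y≡1+tm
  in s ℤ.+ + k ℤ.* t ℤ.* t ℤ.+ s ℤ.* t ℤ.* + m ,
     trans (ℤP.pos-* y (y ^ k)) (trans (cong₂ ℤ._*_ y≡1+tm eq) (step s t (+ k) (+ m)))
  where
  step : ∀ s t k m → (+ 1 ℤ.+ t ℤ.* m) ℤ.* (+ 1 ℤ.+ k ℤ.* t ℤ.* m ℤ.+ s ℤ.* (m ℤ.* m))
    ≡ + 1 ℤ.+ (+ 1 ℤ.+ k) ℤ.* t ℤ.* m ℤ.+ (s ℤ.+ k ℤ.* t ℤ.* t ℤ.+ s ℤ.* t ℤ.* m) ℤ.* (m ℤ.* m)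
  step = ℤSolver.solve-∀

^-distribʳ-* : ∀ k a b → (a * b) ^ k ≡ a ^ k * b ^ k
^-distribʳ-* zero    a b = refl
^-distribʳ-* (suc k) a b = trans (cong (a * b *_) (^-distribʳ-* k a b)) (interchange a b (a ^ k) (b ^ k))
  where
  interchange : ∀ a b c d → a * b * (c * d) ≡ a * c * (b * d)
  interchange = solve-∀

-- The linear term of the expansion is q t m, and the rest is divisible by m * m, hence by q * m.
lift-root : ∀ {y q} → q ∣ m → y ≡ 1 ⟨mod m ⟩ → y ^ q ≡ 1 ⟨mod q * m ⟩
lift-root {m} {y} {q} q∣m (mk (ℤD.divides t eq)) =
  let s , expansion = power-expansion {y} {m} {t} q (trans (sym (cancel (+ y))) (cong (λ z → + 1 ℤ.+ z) eq))
  in mk (subst (+ (q * m) ℤD.∣_) (sym (trans (cong (ℤ._- + 1) expansion) (regroup s t (+ q) (+ m))))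
      (ℤD.∣m∣n⇒∣m+n (ℤD.∣n⇒∣m*n t (ℤD.∣-reflexive (ℤP.pos-* q m)))
                    (ℤD.∣n⇒∣m*n s (subst (+ (q * m) ℤD.∣_) (ℤP.pos-* m m) (ℤD.∣ᵤ⇒∣ (ℕD.*-monoˡ-∣ m q∣m))))))
  where
  cancel : ∀ y → + 1 ℤ.+ (y ℤ.- + 1) ≡ y
  cancel = ℤSolver.solve-∀
  regroup : ∀ s t k m → (+ 1 ℤ.+ k ℤ.* t ℤ.* m ℤ.+ s ℤ.* (m ℤ.* m)) ℤ.- + 1 ≡ t ℤ.* (k ℤ.* m) ℤ.+ s ℤ.* (m ℤ.* m)
  regroup = ℤSolver.solve-∀

lift-root^ : ∀ {y q} a → y ≡ 1 ⟨mod q ⟩ → y ^ (q ^ a) ≡ 1 ⟨mod q ^ suc a ⟩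
lift-root^ {y} {q} zero    y≡1 = subst₂ (λ z m → z ≡ 1 ⟨mod m ⟩) (sym (*-identityʳ y)) (sym (*-identityʳ q)) y≡1
lift-root^ {y} {q} (suc a) y≡1 = subst (λ z → z ≡ 1 ⟨mod q ^ suc (suc a) ⟩)
  (trans (^-*-assoc y (q ^ a) q) (cong (y ^_) (*-comm (q ^ a) q)))
  (lift-root {q = q} (ℕD.m∣m*n (q ^ a)) (lift-root^ a y≡1))

sum-last : ∀ (f : ℕ → ℕ) k → sum {suc k} (f ∘ toℕ) ≡ sum {k} (f ∘ toℕ) + f k
sum-last f zero    = +-comm (f 0) 0
sum-last f (suc k) = trans (cong (λ t → f 0 + t) (sum-last (f ∘ suc) k)) (sym (+-assoc (f 0) _ _))

S-as-sum : ∀ K k → S K k ≡ sum {k} (λ i → suc (toℕ i) ^ K)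
S-as-sum K zero    = refl
S-as-sum K (suc k) = trans (cong (_+ suc k ^ K) (S-as-sum K k)) (sym (sum-last (λ x → suc x ^ K) k))

-- The exponent is positive, so the added term at 0 is 0 and the dropped term at `n` vanishes modulo
-- `n`: the sum may run over `Fin n`, on which `scale` acts.
S-residues : ∀ K n → S (suc K) n ≡ sum {n} (λ i → toℕ i ^ suc K) ⟨mod n ⟩
S-residues K n = begin
  S (suc K) n                                ≈⟨ ≡⇒mod (S-as-sum (suc K) n) ⟩
  sum {suc n} (λ i → toℕ i ^ suc K)          ≈⟨ ≡⇒mod (sum-last (_^ suc K) n) ⟩
  sum {n} (λ i → toℕ i ^ suc K) + n ^ suc K  ≈⟨ mod-+ {a = sum {n} (λ i → toℕ i ^ suc K)} (≡⇒mod refl) (∣⇒mod0 (ℕD.m∣m*n (n ^ K))) ⟩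
  sum {n} (λ i → toℕ i ^ suc K) + 0          ≈⟨ ≡⇒mod (+-identityʳ _) ⟩
  sum {n} (λ i → toℕ i ^ suc K)              ∎
  where open ModReasoning n

S-shift : ∀ K n k → S K (k + n) ≡ S K k + S K n ⟨mod n ⟩
S-shift K n zero    = ≡⇒mod refl
S-shift K n (suc k) = begin
  S K (k + n) + suc (k + n) ^ K    ≈⟨ mod-+ (S-shift K n k) (mod-^ K (+-modulus (suc k) n)) ⟩
  S K k + S K n + suc k ^ K        ≈⟨ ≡⇒mod (lemma (S K k) (S K n) (suc k ^ K)) ⟩
  S K k + suc k ^ K + S K n        ∎
  where
  open ModReasoning n
  lemma : ∀ a b c → a + b + c ≡ a + c + b
  lemma = solve-∀
  +-modulus : ∀ a n → a + n ≡ a ⟨mod n ⟩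
  +-modulus a n = mod-sym (drop-multiple-mod refl ℕD.∣-refl)

S-blocks : ∀ K n t → S K (t * n) ≡ t * S K n ⟨mod n ⟩
S-blocks K n zero    = ≡⇒mod refl
S-blocks K n (suc t) = begin
  S K (n + t * n)      ≈⟨ ≡⇒mod (cong (S K) (+-comm n (t * n))) ⟩
  S K (t * n + n)      ≈⟨ S-shift K n (t * n) ⟩
  S K (t * n) + S K n  ≈⟨ mod-+ (S-blocks K n t) (≡⇒mod refl) ⟩
  t * S K n + S K n    ≈⟨ ≡⇒mod (+-comm (t * S K n) (S K n)) ⟩
  S K n + t * S K n    ∎
  where open ModReasoning n

-- Let Z be the power sum over all residues modulo q ^ a. Permuting them by `g` gives Z ≡ g ^ K Z,
-- and `w`, which is g ^ K - 1, is prime to q and can be cancelled.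
S-vanishes : ∀ {q} K a t → Prime q → q ∸ 1 ∤ suc K → S (suc K) (t * q ^ a) ≡ 0 ⟨mod q ^ a ⟩
S-vanishes {q} K a t pr q-1∤K with nonRoot-∤ (suc K) pr q-1∤K
... | g , q∤g , ¬root = begin
  S (suc K) (t * N)    ≈⟨ S-blocks (suc K) N t ⟩
  t * S (suc K) N      ≈⟨ mod-* {a = t} (≡⇒mod refl) (S-residues K N) ⟩
  t * Z                ≈⟨ mod-* {a = t} (≡⇒mod refl) Z≡0 ⟩
  t * 0                ≈⟨ ≡⇒mod (*-zeroʳ t) ⟩
  0                    ∎
  where
  N = q ^ a
  open ModReasoning N
  instance
    q≢0 : NonZero q
    q≢0 = prime⇒nonZero pr
    N≢0 : NonZero N
    N≢0 = m^n≢0 q a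
  Z = sum {N} (λ i → toℕ i ^ suc K)
  w = pred (g ^ suc K)
  g≢0 : NonZero g
  g≢0 = ≢-nonZero λ { refl → q∤g (q ℕD.∣0) }
  gᴷ≡1+w : g ^ suc K ≡ 1 + w
  gᴷ≡1+w = sym (suc-pred (g ^ suc K) {{m^n≢0 g (suc K) {{g≢0}}}})
  q∤w : q ∤ w
  q∤w q∣w = ¬root (mod-sym (drop-multiple-mod (sym gᴷ≡1+w) q∣w))
  scaled : ∀ (i : Fin N) → toℕ (scale g i) ^ suc K ≡ g ^ suc K * toℕ i ^ suc K ⟨mod N ⟩
  scaled i = mod-trans (mod-^ (suc K) (mod-trans (≡⇒mod (toℕ-scale g i)) (%-mod (g * toℕ i) N)))
                       (≡⇒mod (^-distribʳ-* (suc K) g (toℕ i)))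
  Z≡gᴷZ : Z ≡ g ^ suc K * Z ⟨mod N ⟩
  Z≡gᴷZ = begin
    Z                                               ≈⟨ ≡⇒mod (sum-permute-scale g (Coprime.sym (coprime-^ a (prime∤⇒coprime pr q∤g))) (λ i → toℕ i ^ suc K)) ⟩
    sum {N} (λ i → toℕ (scale g i) ^ suc K)         ≈⟨ sum-mod-cong scaled ⟩
    sum {N} (λ i → g ^ suc K * toℕ i ^ suc K)       ≈⟨ ≡⇒mod (sum-scale {N} (g ^ suc K) (λ i → toℕ i ^ suc K)) ⟩
    g ^ suc K * Z                                   ∎
  Z≡0 : Z ≡ 0 ⟨mod N ⟩
  Z≡0 = mod-*-cancelˡ w (coprime-^ a (prime∤⇒coprime pr q∤w)) (mod-+-cancelʳ Z (begin
    w * Z + Z      ≈⟨ ≡⇒mod (trans (+-comm (w * Z) Z) (cong (_* Z) (sym gᴷ≡1+w))) ⟩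
    g ^ suc K * Z  ≈⟨ mod-sym Z≡gᴷZ ⟩
    Z              ≈⟨ ≡⇒mod (cong (_+ Z) (sym (*-zeroʳ w))) ⟩
    w * 0 + Z      ∎))

S-units : ∀ {q m} K → (∀ x → q ∤ x → x ^ K ≡ 1 ⟨mod m ⟩) → ∀ t r → r < q → S K (t * q + r) ≡ S K (t * q) + r ⟨mod m ⟩
S-units {q} K unit t zero    _ = ≡⇒mod (trans (cong (S K) (+-identityʳ (t * q))) (sym (+-identityʳ _)))
S-units {q} {m} K unit t (suc r) sr<q = begin
  S K (t * q + suc r)                       ≈⟨ ≡⇒mod (cong (S K) (+-suc (t * q) r)) ⟩
  S K (t * q + r) + suc (t * q + r) ^ K     ≈⟨ mod-+ (S-units K unit t r (<-trans (n<1+n r) sr<q)) (unit _ q∤) ⟩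
  S K (t * q) + r + 1                       ≈⟨ ≡⇒mod (trans (+-assoc (S K (t * q)) r 1) (cong (λ z → S K (t * q) + z) (+-comm r 1))) ⟩
  S K (t * q) + suc r                       ∎
  where
  open ModReasoning m
  q∤ : q ∤ suc (t * q + r)
  q∤ q∣ = ℕD.>⇒∤ sr<q (ℕD.∣m+n∣m⇒∣n (subst (q ∣_) (sym (+-suc (t * q) r)) q∣) (ℕD.n∣m*n t))

-- Each block of q consecutive integers has q - 1 units, contributing 1 each, and one multiple of q,
-- contributing 0. The term `t` stands on the left to avoid a subtraction.
S-count : ∀ {q m} K → (∀ x → q ∤ x → x ^ K ≡ 1 ⟨mod m ⟩) → (∀ x → q ∣ x → x ^ K ≡ 0 ⟨mod m ⟩) → 0 < q →
          ∀ t → S K (t * q) + t ≡ t * q ⟨mod m ⟩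
S-count K unit nonunit _ zero = ≡⇒mod refl
S-count {q@(suc r)} {m} K unit nonunit 0<q (suc t) = begin
  S K (suc t * q) + suc t                               ≈⟨ ≡⇒mod (cong (λ k → S K k + suc t) (trans (+-comm q (t * q)) (+-suc (t * q) r))) ⟩
  S K (t * q + r) + suc (t * q + r) ^ K + suc t         ≈⟨ mod-+ {c = suc t} (mod-+ (S-units K unit t r ≤-refl) (nonunit _ q∣)) (≡⇒mod refl) ⟩
  S K (t * q) + r + 0 + suc t                           ≈⟨ ≡⇒mod (lemma (S K (t * q)) r t) ⟩
  S K (t * q) + t + q                                   ≈⟨ mod-+ {c = q} (S-count K unit nonunit 0<q t) (≡⇒mod refl) ⟩
  t * q + q                                             ≈⟨ ≡⇒mod (+-comm (t * q) q) ⟩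
  suc t * q                                             ∎
  where
  open ModReasoning m
  q∣ : q ∣ suc (t * q + r)
  q∣ = subst (q ∣_) (+-suc (t * q) r) (ℕD.∣m∣n⇒∣m+n (ℕD.n∣m*n t) ℕD.∣-refl)
  lemma : ∀ s r t → s + r + 0 + suc t ≡ s + t + suc r
  lemma = solve-∀

n≤b^n : ∀ b n → 1 < b → n ≤ b ^ n
n≤b^n b zero    1<b = z≤n
n≤b^n b (suc n) 1<b = begin
  suc n          ≤⟨ +-mono-≤ {1} (m^n>0 b {{>-nonZero (<-trans (s≤s z≤n) 1<b)}} n) (n≤b^n b n 1<b) ⟩
  b ^ n + b ^ n  ≡⟨ cong (λ z → b ^ n + z) (sym (+-identityʳ (b ^ n))) ⟩
  2 * b ^ n      ≤⟨ *-monoˡ-≤ (b ^ n) 1<b ⟩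
  b * b ^ n      ∎
  where open ≤-Reasoning

-- As q - 1 is prime to q it divides `m`, so a unit satisfies x ^ m ≡ 1 modulo q by Fermat, and the
-- power q ^ a lifts this to the modulus q ^ a. Multiples of q vanish since a ≤ K. Hence the sum
-- counts the units up to K, which are K - c with c = K / q.
S-nonvanishing : ∀ {q} a m c → Prime q → .{{_ : NonZero (m * q ^ a)}} → m * q ^ a ≡ c * q → q ∸ 1 ∣ m * q ^ a →
                 S (m * q ^ a) (m * q ^ a) + c ≡ 0 ⟨mod q ^ a ⟩
S-nonvanishing {q} a m c pr mqᵃ≡cq q-1∣ = begin
  S K K + c        ≈⟨ ≡⇒mod (cong (λ k → S K k + c) mqᵃ≡cq) ⟩
  S K (c * q) + c  ≈⟨ S-count K unit nonunit (<-trans (s≤s z≤n) (prime>1 pr)) c ⟩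
  c * q            ≈⟨ ≡⇒mod (sym mqᵃ≡cq) ⟩
  m * q ^ a        ≈⟨ ∣⇒mod0 (ℕD.n∣m*n m) ⟩
  0                ∎
  where
  open ModReasoning (q ^ a)
  K = m * q ^ a
  instance
    q≢0 : NonZero q
    q≢0 = prime⇒nonZero pr
  a≤K : a ≤ K
  a≤K = ≤-trans (n≤b^n q a (prime>1 pr)) (ℕD.∣⇒≤ (ℕD.n∣m*n m))
  nonunit : ∀ x → q ∣ x → x ^ K ≡ 0 ⟨mod q ^ a ⟩
  nonunit x q∣x = ∣⇒mod0 (∣⇒^∣^ a K q∣x a≤K)
  qᵃ-coprime : Coprime (q ∸ 1) (q ^ a)
  qᵃ-coprime = Coprime.sym (coprime-^ a (prime∤⇒coprime pr q∤q-1))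
    where
    q∤q-1 : q ∤ q ∸ 1
    q∤q-1 = ℕD.>⇒∤ {{>-nonZero (m<n⇒0<n∸m (prime>1 pr))}} (∸-monoʳ-< {q} {1} {0} (s≤s z≤n) (<⇒≤ (prime>1 pr)))
  q-1∣m : q ∸ 1 ∣ m
  q-1∣m = coprime-divisor qᵃ-coprime (subst (q ∸ 1 ∣_) (*-comm m (q ^ a)) q-1∣)
  unit : ∀ x → q ∤ x → x ^ K ≡ 1 ⟨mod q ^ a ⟩
  unit x q∤x with q-1∣m
  -- The lifting even reaches the modulus q ^ (a + 1); the surplus factor q is dropped.
  ... | divides h m≡h[q-1] = mod-∣ (ℕD.n∣m*n q)
      (mod-trans (≡⇒mod (sym (^-*-assoc x m (q ^ a)))) (lift-root^ a xᵐ≡1))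
    where
    xᵐ≡1 : x ^ m ≡ 1 ⟨mod q ⟩
    xᵐ≡1 = mod-trans (≡⇒mod (trans (cong (x ^_) (trans m≡h[q-1] (*-comm h (q ∸ 1)))) (sym (^-*-assoc x (q ∸ 1) h))))
      (mod-trans (mod-^ h (fermat x pr q∤x)) (≡⇒mod (^-zeroˡ h)))

-- The local description of 𝔑_Q

primeDivisor : ∀ k → .{{_ : NonZero k}} → k ≡ 1 ⊎ (∃[ q ] Prime q × q ∣ k)
primeDivisor k with factorise k
... | record { factors = []      ; isFactorisation = k≡1 }                         = inj₁ k≡1
... | record { factors = q ∷ qs ; isFactorisation = k≡q* ; factorsPrime = pr ∷ _ } =
  inj₂ (q , pr , subst (q ∣_) (sym k≡q*) (ℕD.m∣m*n _))

PrimePart : ℕ → ℕ → Set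
PrimePart q k = ∃₂ λ a m → k ≡ m * q ^ a × q ∤ m

primePart : ∀ {q} → Prime q → ∀ k → .{{NonZero k}} → PrimePart q k
primePart {q} pr = <-rec (λ k → .{{NonZero k}} → PrimePart q k) go
  where
  go : ∀ k → (∀ {j} → j < k → .{{NonZero j}} → PrimePart q j) → .{{NonZero k}} → PrimePart q k
  go k rec with q ℕD.∣? k
  ... | no q∤k = 0 , k , sym (*-identityʳ k) , q∤k
  ... | yes q∣k@(divides j k≡jq) =
    let a , m , j≡mqᵃ , q∤m = rec (ℕD.quotient-< q∣k {{prime⇒nonTrivial pr}}) {{ℕD.quotient≢0 q∣k}}
    in suc a , m , trans k≡jq (trans (cong (_* q) j≡mqᵃ) (lemma m (q ^ a) q)) , q∤m
    where
    lemma : ∀ m x q → m * x * q ≡ m * (q * x)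
    lemma = solve-∀

coprime-*-∣ : ∀ {x} m n → Coprime m n → m ∣ x → n ∣ x → m * n ∣ x
coprime-*-∣ {x} m n cop (divides c x≡cm) n∣x =
  subst (m * n ∣_) (trans (*-comm m c) (sym x≡cm))
    (ℕD.*-monoʳ-∣ m (coprime-divisor (Coprime.sym cop) (subst (n ∣_) (trans x≡cm (*-comm c m)) n∣x)))

-- Strong induction that splits off the full power of one prime divisor; the cofactor is smaller and
-- prime to it.
primePowers⇒∣ : ∀ {x} k → .{{NonZero k}} → (∀ q a → Prime q → q ^ a ∣ k → q ^ a ∣ x) → k ∣ x
primePowers⇒∣ {x} = <-rec (λ k → .{{NonZero k}} → (∀ q a → Prime q → q ^ a ∣ k → q ^ a ∣ x) → k ∣ x) go
  where
  go : ∀ k → (∀ {j} → j < k → .{{NonZero j}} → (∀ q a → Prime q → q ^ a ∣ j → q ^ a ∣ x) → j ∣ x) →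
       .{{NonZero k}} → (∀ q a → Prime q → q ^ a ∣ k → q ^ a ∣ x) → k ∣ x
  go k rec pow with primeDivisor k
  ... | inj₁ k≡1 = subst (_∣ x) (sym k≡1) (ℕD.1∣ x)
  ... | inj₂ (q , pr , q∣k) with primePart pr k
  ...   | zero  , m , k≡m   , q∤m = ⊥-elim (q∤m (subst (q ∣_) (trans k≡m (*-identityʳ m)) q∣k))
  ...   | suc a , m , k≡mqᵃ , q∤m =
    subst (_∣ x) (sym k≡mqᵃ) (coprime-*-∣ m (q ^ suc a) (Coprime.sym (coprime-^ (suc a) (prime∤⇒coprime pr q∤m)))
      (rec m<k {{m≢0}} (λ r b pr′ rᵇ∣m → pow r b pr′ (ℕD.∣-trans rᵇ∣m m∣k)))
      (pow q (suc a) pr (divides m k≡mqᵃ)))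
    where
    m∣k : m ∣ k
    m∣k = divides (q ^ suc a) (trans k≡mqᵃ (*-comm m _))
    m≢0 : NonZero m
    m≢0 = ≢-nonZero λ { refl → q∤m (q ℕD.∣0) }
    m<k : m < k
    m<k = subst (m <_) (sym k≡mqᵃ) (m<m*n m (q ^ suc a) {{m≢0}}
      (≤-trans (prime>1 pr) (m≤m*n q (q ^ a) {{m^n≢0 q a {{prime⇒nonZero pr}}}})))

primeParts⇒∣ : ∀ {x} k → .{{NonZero k}} → (∀ q a m → Prime q → k ≡ m * q ^ a → q ∤ m → q ^ a ∣ x) → k ∣ x
primeParts⇒∣ k parts = primePowers⇒∣ k λ q b pr qᵇ∣k →
  let a , m , k≡mqᵃ , q∤m = primePart pr k
  in ℕD.∣-trans (coprime-divisor (coprime-^ b (prime∤⇒coprime pr q∤m)) (subst (q ^ b ∣_) k≡mqᵃ qᵇ∣k))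
                (parts q a m pr k≡mqᵃ q∤m)

-- Turns the decision made inside `primeQuotSum` into a disjunction that later inductions can match
-- on.
primeQuotSum-suc : ∀ Q k →
  (Prime (suc k) × suc k ∣ Q × primeQuotSum Q (suc k) ≡ primeQuotSum Q k + Q / suc k)
  ⊎ (¬ (Prime (suc k) × suc k ∣ Q) × primeQuotSum Q (suc k) ≡ primeQuotSum Q k)
primeQuotSum-suc Q k with (prime? (suc k)) ×-dec (suc k ℕD.∣? Q)
... | yes (pr , k∣Q) = inj₁ (pr , k∣Q , refl)
... | no ¬pr         = inj₂ (¬pr , refl)

distinctPrimes⇒∤ : ∀ {q} → Prime p → Prime q → p ≢ q → q ∤ p
distinctPrimes⇒∤ pr-p pr-q p≢q q∣p with prime⇒irreducible pr-p q∣p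
... | inj₁ refl = <⇒≢ (prime>1 pr-q) refl
... | inj₂ refl = p≢q refl

module _ {Q n q a c} (pr : Prime q) (q∣Q : q ∣ Q) (Qn≡cq : Q * n ≡ c * q) (qᵃ∣Qn : q ^ a ∣ Q * n) where

  private
    otherTerm : ∀ k → Prime (suc k) → suc k ∣ Q → suc k ≢ q → q ^ a ∣ n * (Q / suc k)
    otherTerm k pr′ k∣Q k≢q = coprime-divisor {n = suc k} (coprime-^ a (prime∤⇒coprime pr (distinctPrimes⇒∤ pr′ pr k≢q)))
      (subst (q ^ a ∣_) eq qᵃ∣Qn)
      where
      lemma : ∀ n x p → p * x * n ≡ p * (n * x)
      lemma = solve-∀
      eq : Q * n ≡ suc k * (n * (Q / suc k))
      eq = trans (cong (_* n) (sym (m*[n/m]≡n k∣Q))) (lemma n (Q / suc k) (suc k))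

    ownTerm : ∀ k → suc k ≡ q → n * (Q / suc k) ≡ c
    ownTerm k refl = *-cancelʳ-≡ _ _ (suc k) (begin
      n * (Q / suc k) * suc k   ≡⟨ *-assoc n _ _ ⟩
      n * (Q / suc k * suc k)   ≡⟨ cong (n *_) (m/n*n≡m q∣Q) ⟩
      n * Q                     ≡⟨ *-comm n Q ⟩
      Q * n                     ≡⟨ Qn≡cq ⟩
      c * suc k                 ∎)
      where open ≡-Reasoning

  -- For a prime p ≠ q the term n Q / p vanishes modulo q ^ a, since q ^ a divides p (n Q / p) = Q n
  -- and is prime to p. The term at q equals Q n / q = c. So the partial sums jump once, from 0 to
  -- `c`, at k = q.
  primeQuotSum-local : ∀ k → (k < q → n * primeQuotSum Q k ≡ 0 ⟨mod q ^ a ⟩)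
                           × (q ≤ k → n * primeQuotSum Q k ≡ c ⟨mod q ^ a ⟩)
  primeQuotSum-local zero = (λ _ → ≡⇒mod (*-zeroʳ n)) , λ q≤0 → ⊥-elim (<⇒≱ (<-trans (s≤s z≤n) (prime>1 pr)) q≤0)
  primeQuotSum-local (suc k) with primeQuotSum-local k | primeQuotSum-suc Q k | suc k ≟ q
  ... | below , above | inj₁ (pr′ , k∣Q , eq) | yes k≡q =
    (λ k<q → ⊥-elim (<⇒≢ k<q k≡q)) ,
    (λ _ → mod-trans (≡⇒mod (trans (cong (n *_) eq) (*-distribˡ-+ n (primeQuotSum Q k) _)))
             (mod-+ (below (≤-reflexive k≡q)) (≡⇒mod (ownTerm k k≡q))))
  ... | below , above | inj₁ (pr′ , k∣Q , eq) | no k≢q =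
    (λ k<q → step (below (<-trans (n<1+n k) k<q))) ,
    (λ q≤k → step (above (s≤s⁻¹ (≤∧≢⇒< q≤k (k≢q ∘ sym)))))
    where
    step : ∀ {x} → n * primeQuotSum Q k ≡ x ⟨mod q ^ a ⟩ → n * primeQuotSum Q (suc k) ≡ x ⟨mod q ^ a ⟩
    step {x} e = mod-trans (≡⇒mod (trans (cong (n *_) eq) (*-distribˡ-+ n (primeQuotSum Q k) _)))
      (mod-trans (mod-+ e (∣⇒mod0 (otherTerm k pr′ k∣Q k≢q))) (≡⇒mod (+-identityʳ x)))
  ... | below , above | inj₂ (¬pr , eq) | yes refl = ⊥-elim (¬pr (pr , q∣Q))
  ... | below , above | inj₂ (¬pr , eq) | no k≢q =
    (λ k<q → step (below (<-trans (n<1+n k) k<q))) ,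
    (λ q≤k → step (above (s≤s⁻¹ (≤∧≢⇒< q≤k (k≢q ∘ sym)))))
    where
    step : ∀ {x} → n * primeQuotSum Q k ≡ x ⟨mod q ^ a ⟩ → n * primeQuotSum Q (suc k) ≡ x ⟨mod q ^ a ⟩
    step = mod-trans (≡⇒mod (cong (n *_) eq))

-- Membership in 𝔑_Q at the prime q: q ∣ Q ⇔ q ∣ Q n × q - 1 ∣ Q n.  The parts of this equivalence
-- that hold for every n are left out.
Local : ℕ → ℕ → ℕ → Set
Local Q n q = Prime q → (q ∣ Q → q ∸ 1 ∣ Q * n) × (q ∣ n → q ∸ 1 ∣ Q * n → q ∣ Q)

module _ {Q n} (ppn : WeakPPN Q) (1≤n : 1 ≤ n) where
  private
    K = Q * n
    instance
      n≢0 : NonZero n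
      n≢0 = >-nonZero 1≤n
      Q≢0 : NonZero Q
      Q≢0 = >-nonZero (proj₁ ppn)
      K≢0 : NonZero K
      K≢0 = m*n≢0 Q n

    module _ {q m} a (pr : Prime q) (K≡mqᵃ : K ≡ m * q ^ a) (q∤m : q ∤ m) where
      qᵃ∣K : q ^ a ∣ K
      qᵃ∣K = divides m K≡mqᵃ

      -- The congruence in `ppn` times n says that K divides n + n * sumQoverP Q, and the second
      -- summand is `c` modulo q ^ a.
      n-dividing : ∀ {c} → q ∣ Q → K ≡ c * q → n + c ≡ 0 ⟨mod q ^ a ⟩
      n-dividing {c} q∣Q K≡cq = mod-trans (mod-+ {a = n} (≡⇒mod refl)
          (mod-sym (proj₂ (primeQuotSum-local {a = a} pr q∣Q K≡cq qᵃ∣K Q) (ℕD.∣⇒≤ q∣Q))))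
        (∣⇒mod0 (ℕD.∣-trans qᵃ∣K (subst (K ∣_) (lemma n (sumQoverP Q))
          (ℕD.*-monoˡ-∣ n (mod0⇒∣ (fromMod (sumQoverP Q + 1) 0 Q (proj₂ ppn)))))))
        where
        lemma : ∀ n s → (s + 1) * n ≡ n + n * s
        lemma = solve-∀

      n-nondividing : q ∤ Q → n ≡ 0 ⟨mod q ^ a ⟩
      n-nondividing q∤Q = ∣⇒mod0 (coprime-divisor (coprime-^ a (prime∤⇒coprime pr q∤Q)) qᵃ∣K)

      S-dividing : ∀ {c} → K ≡ c * q → q ∸ 1 ∣ K → S K K + c ≡ 0 ⟨mod q ^ a ⟩
      S-dividing {c} K≡cq q-1∣K = subst (λ k → S k k + c ≡ 0 ⟨mod q ^ a ⟩) (sym K≡mqᵃ)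
        (S-nonvanishing a m c pr {{subst NonZero K≡mqᵃ K≢0}} (trans (sym K≡mqᵃ) K≡cq) (subst (q ∸ 1 ∣_) K≡mqᵃ q-1∣K))

      S-nondividing : q ∸ 1 ∤ K → S K K ≡ 0 ⟨mod q ^ a ⟩
      S-nondividing q-1∤K = subst₂ (λ e k → S e k ≡ 0 ⟨mod q ^ a ⟩) (suc-pred K) (sym K≡mqᵃ)
        (S-vanishes (pred K) a m pr (q-1∤K ∘ subst (q ∸ 1 ∣_) (suc-pred K)))

      -- If q ^ a divided K / q, then q ^ (a + 1) would divide K, against q ∤ m. This is what tells
      -- the residues 0 and - K / q apart.
      quotient≢0 : ∀ {c} → K ≡ c * q → ¬ (c ≡ 0 ⟨mod q ^ a ⟩)
      quotient≢0 {c} K≡cq c≡0 = q∤m (ℕD.*-cancelʳ-∣ {q} {m} (q ^ a) {{m^n≢0 q a {{prime⇒nonZero pr}}}}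
        (subst₂ _∣_ (*-comm (q ^ a) q) (trans (sym K≡cq) K≡mqᵃ) (ℕD.*-monoˡ-∣ q (mod0⇒∣ c≡0))))

  -- If either half of `Local` failed, one side of S ≡ n would be 0 modulo q ^ a and the other - K /
  -- q, against `quotient≢0`.
  InN⇒Local : InN Q n → ∀ q → Local Q n q
  InN⇒Local (_ , inN) q pr with primePart pr K
  ... | a , m , K≡mqᵃ , q∤m = dividing , nondividing
    where
    S≡n : S K K ≡ n ⟨mod q ^ a ⟩
    S≡n = mod-∣ (qᵃ∣K a pr K≡mqᵃ q∤m) (fromMod (S K K) n K inN)
    dividing : q ∣ Q → q ∸ 1 ∣ K
    dividing q∣Q@(divides r Q≡rq) with (q ∸ 1) ℕD.∣? K
    ... | yes q-1∣K = q-1∣K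
    ... | no q-1∤K = ⊥-elim (quotient≢0 a pr K≡mqᵃ q∤m K≡cq (mod-trans
        (mod-+ {b = n} (mod-trans (mod-sym (S-nondividing a pr K≡mqᵃ q∤m q-1∤K)) S≡n) (≡⇒mod {r * n} refl))
        (n-dividing a pr K≡mqᵃ q∤m q∣Q K≡cq)))
      where
      lemma : ∀ r q n → r * q * n ≡ r * n * q
      lemma = solve-∀
      K≡cq : K ≡ r * n * q
      K≡cq = trans (cong (_* n) Q≡rq) (lemma r q n)
    nondividing : q ∣ n → q ∸ 1 ∣ K → q ∣ Q
    nondividing (divides r n≡rq) q-1∣K with q ℕD.∣? Q
    ... | yes q∣Q = q∣Q
    ... | no q∤Q = ⊥-elim (quotient≢0 a pr K≡mqᵃ q∤m K≡cq (mod-trans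
        (mod-+ {b = S K K} (mod-trans (mod-sym (n-nondividing a pr K≡mqᵃ q∤m q∤Q)) (mod-sym S≡n)) (≡⇒mod {Q * r} refl))
        (S-dividing a pr K≡mqᵃ q∤m K≡cq q-1∣K)))
      where
      K≡cq : K ≡ Q * r * q
      K≡cq = trans (cong (Q *_) n≡rq) (sym (*-assoc Q r q))

  Local⇒InN : (∀ q → Local Q n q) → InN Q n
  Local⇒InN local = 1≤n , primeParts⇒∣ K λ q a m pr K≡mqᵃ q∤m → toMod (agree q a m pr K≡mqᵃ q∤m)
    where
    agree : ∀ q a m → Prime q → K ≡ m * q ^ a → q ∤ m → S K K ≡ n ⟨mod q ^ a ⟩
    -- The modulus is 1. A positive exponent is needed below, both to write K as a multiple of q and
    -- to obtain q ∣ n from q ∤ Q.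
    agree q zero m pr K≡m q∤m = mod-trans (∣⇒mod0 (ℕD.1∣ _)) (mod-sym (∣⇒mod0 (ℕD.1∣ _)))
    agree q a@(suc b) m pr K≡mqᵃ q∤m with (q ∸ 1) ℕD.∣? K | q ℕD.∣? Q
    ... | yes q-1∣K | yes q∣Q = mod-+-cancelʳ (m * q ^ b) (mod-trans (S-dividing a pr K≡mqᵃ q∤m K≡cq q-1∣K)
                                  (mod-sym (n-dividing a pr K≡mqᵃ q∤m q∣Q K≡cq)))
      where
      lemma : ∀ m q x → m * (q * x) ≡ m * x * q
      lemma = solve-∀
      K≡cq : K ≡ m * q ^ b * q
      K≡cq = trans K≡mqᵃ (lemma m q (q ^ b))
    ... | no q-1∤K  | no q∤Q  = mod-trans (S-nondividing a pr K≡mqᵃ q∤m q-1∤K) (mod-sym (n-nondividing a pr K≡mqᵃ q∤m q∤Q))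
    ... | no q-1∤K  | yes q∣Q = ⊥-elim (q-1∤K (proj₁ (local q pr) q∣Q))
    ... | yes q-1∣K | no q∤Q  = ⊥-elim (q∤Q (proj₂ (local q pr) q∣n q-1∣K))
      where
      q∣n : q ∣ n
      q∣n = Sum.[ (λ q∣Q → ⊥-elim (q∤Q q∣Q)) , (λ q∣n → q∣n) ]′
        (euclidsLemma Q n pr (ℕD.∣-trans (ℕD.m∣m*n (q ^ b)) (divides m K≡mqᵃ)))

-- Counting

∑ : (ℕ → ℕ) → ℕ → ℕ
∑ f zero    = 0
∑ f (suc k) = ∑ f k + f k

∑-+ : ∀ f g k → ∑ (λ i → f i + g i) k ≡ ∑ f k + ∑ g k
∑-+ f g zero    = refl
∑-+ f g (suc k) = trans (cong (_+ (f k + g k)) (∑-+ f g k)) (lemma (∑ f k) (∑ g k) (f k) (g k))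
  where
  lemma : ∀ a b c d → a + b + (c + d) ≡ a + c + (b + d)
  lemma = solve-∀

-- Sets aside one element per term, the part of the count of bad indices that their spacing does not
-- control.
∑≤∑pred+k : ∀ f k → ∑ f k ≤ ∑ (λ i → pred (f i)) k + k
∑≤∑pred+k f zero    = z≤n
∑≤∑pred+k f (suc k) = begin
  ∑ f k + f k                                     ≤⟨ +-mono-≤ (∑≤∑pred+k f k) (suc-pred-≤ (f k)) ⟩
  ∑ (λ i → pred (f i)) k + k + (1 + pred (f k))   ≡⟨ lemma (∑ (λ i → pred (f i)) k) k (pred (f k)) ⟩
  ∑ (λ i → pred (f i)) k + pred (f k) + suc k     ∎
  where
  open ≤-Reasoning
  suc-pred-≤ : ∀ n → n ≤ suc (pred n)
  suc-pred-≤ zero    = z≤n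
  suc-pred-≤ (suc n) = ≤-refl
  lemma : ∀ a k b → a + k + (1 + b) ≡ a + b + suc k
  lemma = solve-∀

term≤∑ : ∀ f {i k} → i < k → f i ≤ ∑ f k
term≤∑ f {i} {suc k} i<sk with m≤n⇒m<n∨m≡n (s≤s⁻¹ i<sk)
... | inj₁ i<k  = ≤-trans (term≤∑ f i<k) (m≤m+n _ (f k))
... | inj₂ refl = m≤n+m (f k) _

∑-mono-≤ : ∀ {f g} k → (∀ i → i < k → f i ≤ g i) → ∑ f k ≤ ∑ g k
∑-mono-≤ zero    f≤g = z≤n
∑-mono-≤ (suc k) f≤g = +-mono-≤ (∑-mono-≤ k (λ i i<k → f≤g i (<-trans i<k (n<1+n k)))) (f≤g k ≤-refl)

∑-split : ∀ f j k → ∑ f (j + k) ≡ ∑ f j + ∑ (λ i → f (j + i)) k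
∑-split f j zero    = trans (cong (∑ f) (+-identityʳ j)) (sym (+-identityʳ _))
∑-split f j (suc k) = trans (cong (∑ f) (+-suc j k))
  (trans (cong (_+ f (j + k)) (∑-split f j k)) (+-assoc (∑ f j) _ _))

-- The sum of 1 / (p (p - 1)) over p > T telescopes to at most 1 / T.
telescope : ∀ {Y} T .{{_ : NonZero T}} f k → (∀ i → i < k → f i * (suc (T + i) * (T + i)) ≤ Y) → T * ∑ f k ≤ Y
telescope {Y} T f k bound = *-cancelʳ-≤ _ _ (T + k) {{>-nonZero (<-≤-trans (>-nonZero⁻¹ T) (m≤m+n T k))}} (begin
    T * ∑ f k * (T + k)          ≤⟨ m≤m+n _ (Y * T) ⟩
    T * ∑ f k * (T + k) + Y * T  ≤⟨ partial k bound ⟩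
    Y * (T + k)                  ∎)
  where
  open ≤-Reasoning
  -- The sharper ∑ f k ≤ Y / T - Y / (T + k), cleared of denominators, is what the induction needs.
  partial : ∀ k → (∀ i → i < k → f i * (suc (T + i) * (T + i)) ≤ Y) → T * ∑ f k * (T + k) + Y * T ≤ Y * (T + k)
  partial zero    _     = ≤-reflexive (cong₂ _+_ (cong (_* (T + 0)) (*-zeroʳ T)) (cong (Y *_) (sym (+-identityʳ T))))
  partial (suc k) bound = *-cancelʳ-≤ _ _ (T + k) {{>-nonZero (<-≤-trans (>-nonZero⁻¹ T) (m≤m+n T k))}}
    (+-cancelʳ-≤ (Y * T) _ _ (begin
      (T * (∑ f k + f k) * (T + suc k) + Y * T) * (T + k) + Y * T
        ≡⟨ expand T (∑ f k) (f k) k Y ⟩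
      suc (T + k) * (T * ∑ f k * (T + k) + Y * T) + T * (f k * (suc (T + k) * (T + k)))
        ≤⟨ +-mono-≤ (*-monoʳ-≤ (suc (T + k)) (partial k (λ i i<k → bound i (<-trans i<k (n<1+n k)))))
                    (*-monoʳ-≤ T (bound k ≤-refl)) ⟩
      suc (T + k) * (Y * (T + k)) + T * Y
        ≡⟨ collect T k Y ⟩
      Y * (T + suc k) * (T + k) + Y * T ∎))
    where
    expand : ∀ T s f k Y → (T * (s + f) * (T + suc k) + Y * T) * (T + k) + Y * T
      ≡ suc (T + k) * (T * s * (T + k) + Y * T) + T * (f * (suc (T + k) * (T + k)))
    expand = solve-∀
    collect : ∀ T k Y → suc (T + k) * (Y * (T + k)) + T * Y ≡ Y * (T + suc k) * (T + k) + Y * T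
    collect = solve-∀

𝟙 : ∀ {A : Set} → Dec A → ℕ
𝟙 (yes _) = 1
𝟙 (no _)  = 0

𝟙-yes : ∀ {A : Set} (A? : Dec A) → A → 1 ≤ 𝟙 A?
𝟙-yes (yes _) _ = ≤-refl
𝟙-yes (no ¬a) a = ⊥-elim (¬a a)

𝟙-mono : ∀ {A B : Set} (A? : Dec A) (B? : Dec B) → (A → B) → 𝟙 A? ≤ 𝟙 B?
𝟙-mono (yes a) B? A⇒B = 𝟙-yes B? (A⇒B a)
𝟙-mono (no _)  B? A⇒B = z≤n

module _ {P : ℕ → Set} (P? : ∀ n → Dec (P n)) where
  count-suc : ∀ N → count P? (suc N) ≡ count P? N + 𝟙 (P? (suc N))
  count-suc N with P? (suc N)
  ... | yes _ = +-comm 1 _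
  ... | no _  = sym (+-identityʳ _)

  count-≤ : ∀ N → count P? N ≤ N
  count-≤ zero    = z≤n
  count-≤ (suc N) with P? (suc N)
  ... | yes _ = s≤s (count-≤ N)
  ... | no _  = m≤n⇒m≤1+n (count-≤ N)

  count-step : ∀ N → count P? N ≤ count P? (suc N)
  count-step N = subst (count P? N ≤_) (sym (count-suc N)) (m≤m+n _ _)

  count-mono : ∀ {m n} → m ≤ n → count P? m ≤ count P? n
  count-mono {m} {zero}  z≤n = ≤-refl
  count-mono {m} {suc n} m≤sn with m≤n⇒m<n∨m≡n m≤sn
  ... | inj₁ m<sn = ≤-trans (count-mono (s≤s⁻¹ m<sn)) (count-step n)
  ... | inj₂ refl = ≤-refl

  -- The first element of P already has weight at least D and each further one adds at least D. The
  -- induction carries the last element found, since `next` compares elements rather than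
  -- neighbouring integers.
  count-separated : ∀ D (w : ℕ → ℕ) → (∀ {i j} → i ≤ j → w i ≤ w j) →
    (∀ i → 1 ≤ i → P i → D ≤ w i) → (∀ i j → 1 ≤ i → i < j → P i → P j → w i + D ≤ w j) →
    ∀ N → count P? N * D ≤ w N
  count-separated D w w-mono first next N = conclude (last N)
    where
    last : ∀ N → count P? N ≡ 0 ⊎ (∃[ i ] 1 ≤ i × i ≤ N × P i × count P? N * D ≤ w i)
    last zero = inj₁ refl
    last (suc N) with P? (suc N) | last N
    ... | no _  | inj₁ c≡0 = inj₁ c≡0
    ... | no _  | inj₂ (i , 1≤i , i≤N , Pi , c≤w) = inj₂ (i , 1≤i , m≤n⇒m≤1+n i≤N , Pi , c≤w)
    ... | yes p | inj₁ c≡0 = inj₂ (suc N , s≤s z≤n , ≤-refl , p ,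
          subst (λ c → D + c * D ≤ w (suc N)) (sym c≡0) (subst (_≤ w (suc N)) (sym (+-identityʳ D)) (first (suc N) (s≤s z≤n) p)))
    ... | yes p | inj₂ (i , 1≤i , i≤N , Pi , c≤w) = inj₂ (suc N , s≤s z≤n , ≤-refl , p ,
          ≤-trans (≤-reflexive (+-comm D _)) (≤-trans (+-monoˡ-≤ D c≤w) (next i (suc N) 1≤i (s≤s i≤N) Pi p)))
    conclude : count P? N ≡ 0 ⊎ (∃[ i ] 1 ≤ i × i ≤ N × P i × count P? N * D ≤ w i) → count P? N * D ≤ w N
    conclude (inj₁ c≡0) = subst (λ c → c * D ≤ w N) (sym c≡0) z≤n
    conclude (inj₂ (i , _ , i≤N , _ , c≤w)) = ≤-trans c≤w (w-mono i≤N)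

  count-∘ : ∀ (g : ℕ → ℕ) → (∀ j → g j < g (suc j)) → ∀ J → count (λ j → P? (g j)) J ≤ count P? (g J)
  count-∘ g g-mono zero    = z≤n
  count-∘ g g-mono (suc J) = begin
    count (λ j → P? (g j)) (suc J)                    ≡⟨ count-suc-∘ ⟩
    count (λ j → P? (g j)) J + 𝟙 (P? (g (suc J)))     ≤⟨ +-monoˡ-≤ _ (count-∘ g g-mono J) ⟩
    count P? (g J) + 𝟙 (P? (g (suc J)))               ≤⟨ jump (g-mono J) ⟩
    count P? (g (suc J))                              ∎
    where
    open ≤-Reasoning
    count-suc-∘ : count (λ j → P? (g j)) (suc J) ≡ count (λ j → P? (g j)) J + 𝟙 (P? (g (suc J)))
    count-suc-∘ with P? (g (suc J))
    ... | yes _ = +-comm 1 _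
    ... | no _  = sym (+-identityʳ _)
    jump : ∀ {m n} → m < n → count P? m + 𝟙 (P? n) ≤ count P? n
    jump {m} {suc n} (s≤s m≤n) = ≤-trans (+-monoˡ-≤ _ (count-mono m≤n)) (≤-reflexive (sym (count-suc n)))

count-⊤ : ∀ N → count {λ _ → ⊤} (λ _ → yes tt) N ≡ N
count-⊤ zero    = refl
count-⊤ (suc N) = cong suc (count-⊤ N)

count-∪ : ∀ {P B : ℕ → Set} {C : ℕ → ℕ → Set} (P? : ∀ n → Dec (P n)) (B? : ∀ n → Dec (B n)) (C? : ∀ i n → Dec (C i n)) k N →
  (∀ n → 1 ≤ n → n ≤ N → P n → B n ⊎ (∃[ i ] i < k × C i n)) →
  count P? N ≤ count B? N + ∑ (λ i → count (C? i) N) k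
count-∪ P? B? C? k zero    cover = z≤n
count-∪ {P} {B} {C} P? B? C? k (suc N) cover = begin
  count P? (suc N)
    ≡⟨ count-suc P? N ⟩
  count P? N + 𝟙 (P? (suc N))
    ≤⟨ +-mono-≤ (count-∪ P? B? C? k N (λ n 1≤n n≤N → cover n 1≤n (m≤n⇒m≤1+n n≤N))) (𝟙-∪ (P? (suc N)) (cover (suc N) (s≤s z≤n) ≤-refl)) ⟩
  count B? N + ∑ (λ i → count (C? i) N) k + (𝟙 (B? (suc N)) + ∑ (λ i → 𝟙 (C? i (suc N))) k)
    ≡⟨ lemma (count B? N) _ _ _ ⟩
  count B? N + 𝟙 (B? (suc N)) + (∑ (λ i → count (C? i) N) k + ∑ (λ i → 𝟙 (C? i (suc N))) k)
    ≡⟨ cong₂ _+_ (sym (count-suc B? N)) (sym (∑-+ (λ i → count (C? i) N) (λ i → 𝟙 (C? i (suc N))) k)) ⟩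
  count B? (suc N) + ∑ (λ i → count (C? i) N + 𝟙 (C? i (suc N))) k
    ≤⟨ +-monoʳ-≤ (count B? (suc N)) (∑-mono-≤ k (λ i _ → ≤-reflexive (sym (count-suc (C? i) N)))) ⟩
  count B? (suc N) + ∑ (λ i → count (C? i) (suc N)) k ∎
  where
  open ≤-Reasoning
  lemma : ∀ a b c d → a + b + (c + d) ≡ a + c + (b + d)
  lemma = solve-∀
  𝟙-∪ : (p? : Dec (P (suc N))) → (P (suc N) → B (suc N) ⊎ (∃[ i ] i < k × C i (suc N))) → 𝟙 p? ≤ 𝟙 (B? (suc N)) + ∑ (λ i → 𝟙 (C? i (suc N))) k
  𝟙-∪ (no _)  _ = z≤n
  𝟙-∪ (yes p) cov with cov p
  ... | inj₁ b = ≤-trans (𝟙-yes (B? (suc N)) b) (m≤m+n _ _)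
  ... | inj₂ (i , i<k , c) = ≤-trans (𝟙-yes (C? i (suc N)) c) (≤-trans (term≤∑ (λ i → 𝟙 (C? i (suc N))) i<k) (m≤n+m _ _))

module _ {P : ℕ → Set} (P? : ∀ n → Dec (P n)) (W : ℕ) .{{_ : NonZero W}}
         (periodic : ∀ n → (P n → P (W + n)) × (P (W + n) → P n)) where

  count-period : ∀ n → count P? (W + n) ≡ count P? W + count P? n
  count-period zero    = trans (cong (count P?) (+-identityʳ W)) (sym (+-identityʳ _))
  count-period (suc n) = begin
    count P? (W + suc n)                       ≡⟨ cong (count P?) (+-suc W n) ⟩
    count P? (suc (W + n))                     ≡⟨ count-suc P? (W + n) ⟩
    count P? (W + n) + 𝟙 (P? (suc (W + n)))    ≡⟨ cong₂ _+_ (count-period n) 𝟙-eq ⟩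
    count P? W + count P? n + 𝟙 (P? (suc n))   ≡⟨ +-assoc (count P? W) _ _ ⟩
    count P? W + (count P? n + 𝟙 (P? (suc n))) ≡⟨ cong (λ z → count P? W + z) (sym (count-suc P? n)) ⟩
    count P? W + count P? (suc n)              ∎
    where
    open ≡-Reasoning
    𝟙-eq : 𝟙 (P? (suc (W + n))) ≡ 𝟙 (P? (suc n))
    𝟙-eq = ≤-antisym
      (𝟙-mono _ _ (λ p → proj₂ (periodic (suc n)) (subst P (sym (+-suc W n)) p)))
      (𝟙-mono _ _ (λ p → subst P (+-suc W n) (proj₁ (periodic (suc n)) p)))

  count-periods : ∀ q r → count P? (q * W + r) ≡ q * count P? W + count P? r
  count-periods zero    r = refl
  count-periods (suc q) r = trans (cong (count P?) (+-assoc W (q * W) r))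
    (trans (count-period (q * W + r)) (trans (cong (λ z → count P? W + z) (count-periods q r)) (sym (+-assoc (count P? W) _ _))))

  private
    count-divMod : ∀ N → count P? N ≡ N / W * count P? W + count P? (N % W)
    count-divMod N = trans (cong (count P?) (trans (m≡m%n+[m/n]*n N W) (+-comm (N % W) _))) (count-periods (N / W) (N % W))

  -- The incomplete last period contributes at most W elements, hence the error W * W after
  -- multiplication by W.
  count-periodic-≤ : ∀ N → W * count P? N ≤ N * count P? W + W * W
  count-periodic-≤ N = begin
    W * count P? N                                  ≡⟨ cong (W *_) (count-divMod N) ⟩
    W * (N / W * count P? W + count P? (N % W))     ≡⟨ lemma W (N / W) (count P? W) _ ⟩
    N / W * W * count P? W + W * count P? (N % W)   ≤⟨ +-mono-≤ (*-monoˡ-≤ (count P? W) (m/n*n≤m N W))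
                                                          (*-monoʳ-≤ W (≤-trans (count-≤ P? (N % W)) (m%n≤n N W))) ⟩
    N * count P? W + W * W                          ∎
    where
    open ≤-Reasoning
    lemma : ∀ W q b c → W * (q * b + c) ≡ q * W * b + W * c
    lemma = solve-∀

  count-periodic-≥ : ∀ N → N * count P? W ≤ W * count P? N + W * W
  count-periodic-≥ N = begin
    N * count P? W                                        ≡⟨ cong (_* count P? W) (m≡m%n+[m/n]*n N W) ⟩
    (N % W + N / W * W) * count P? W                      ≡⟨ lemma W (N / W) (count P? W) (N % W) ⟩
    W * (N / W * count P? W) + N % W * count P? W         ≤⟨ +-mono-≤ (*-monoʳ-≤ W (≤-trans (m≤m+n _ (count P? (N % W))) (≤-reflexive (sym (count-divMod N)))))
                                                               (*-mono-≤ (m%n≤n N W) (count-≤ P? W)) ⟩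
    W * count P? N + W * W                                ∎
    where
    open ≤-Reasoning
    lemma : ∀ W q b r → (r + q * W) * b ≡ W * (q * b) + r * b
    lemma = solve-∀

-- Densities

-- Cleared of denominators: a N / N ≤ β / W + W / N and β / W ≤ a N / N + W / N + C / T, where β / W
-- is the density of a periodic set.
PeriodicApproximable : (ℕ → ℕ) → ℕ → Set
PeriodicApproximable a C = ∀ T → C ≤ T → ∃₂ λ W β → 1 ≤ W × (∀ N →
  W * a N ≤ N * β + W * W × T * (N * β) ≤ T * (W * a N + W * W) + W * (C * N))

-- This is a m / m - a n / n < 1 / d multiplied by d m n. It is one-sided; exchanging m and n gives
-- the absolute value.
CrossCauchy : (ℕ → ℕ) → Set
CrossCauchy a = ∀ d → .{{NonZero d}} → ∃[ M ] ∀ m n → M ≤ m → M ≤ n → 1 ≤ m → 1 ≤ n →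
  d * (a m * n) < d * (a n * m) + m * n

periodicApproximable⇒cauchy : ∀ a C → .{{NonZero C}} → PeriodicApproximable a C → CrossCauchy a
-- T = 4 C d makes C / T equal to 1 / (4 d), and m, n ≥ 4 d W make W / m and W / n at most 1 / (4 d)
-- each. The total 3 / (4 d) leaves room for strictness.
periodicApproximable⇒cauchy a C approx d with approx (4 * C * d) (≤-trans (m≤n*m C 4) (m≤m*n (4 * C) d))
... | W , β , 1≤W , bounds = 4 * (d * W) , cross
  where
  open ≤-Reasoning
  T = 4 * C * d
  instance
    W≢0 : NonZero W
    W≢0 = >-nonZero 1≤W
  cleared : ∀ m n → 4 * d * (a m * n) ≤ 4 * d * (a n * m) + (4 * (d * W) * n + 4 * (d * W) * m + m * n)
  cleared m n = *-cancelˡ-≤ (C * W) {{m*n≢0 C W}} (begin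
    C * W * (4 * d * (a m * n))                        ≡⟨ lhs C W d (a m) n ⟩
    T * n * (W * a m)                                  ≤⟨ *-monoʳ-≤ (T * n) (proj₁ (bounds m)) ⟩
    T * n * (m * β + W * W)                            ≡⟨ mid T n m β W ⟩
    m * (T * (n * β)) + T * n * (W * W)                ≤⟨ +-monoˡ-≤ (T * n * (W * W)) (*-monoʳ-≤ m (proj₂ (bounds n))) ⟩
    m * (T * (W * a n + W * W) + W * (C * n)) + T * n * (W * W) ≡⟨ rhs C W d (a n) n m ⟩
    C * W * (4 * d * (a n * m) + (4 * (d * W) * n + 4 * (d * W) * m + m * n)) ∎)
    where
    lhs : ∀ C W d a n → C * W * (4 * d * (a * n)) ≡ 4 * C * d * n * (W * a)
    lhs = solve-∀
    mid : ∀ T n m β W → T * n * (m * β + W * W) ≡ m * (T * (n * β)) + T * n * (W * W)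
    mid = solve-∀
    rhs : ∀ C W d a n m → m * (4 * C * d * (W * a + W * W) + W * (C * n)) + 4 * C * d * n * (W * W)
      ≡ C * W * (4 * d * (a * m) + (4 * (d * W) * n + 4 * (d * W) * m + m * n))
    rhs = solve-∀
  cross : ∀ m n → 4 * (d * W) ≤ m → 4 * (d * W) ≤ n → 1 ≤ m → 1 ≤ n → d * (a m * n) < d * (a n * m) + m * n
  cross m n M≤m M≤n 1≤m 1≤n = *-cancelˡ-< 4 _ _ (begin-strict
    4 * (d * (a m * n))                                      ≡⟨ sym (*-assoc 4 d _) ⟩
    4 * d * (a m * n)                                        ≤⟨ cleared m n ⟩
    4 * d * (a n * m) + (4 * (d * W) * n + 4 * (d * W) * m + m * n)
      ≤⟨ +-monoʳ-≤ (4 * d * (a n * m)) (+-monoˡ-≤ (m * n) (+-mono-≤ (*-monoˡ-≤ n M≤m) (*-monoˡ-≤ m M≤n))) ⟩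
    4 * d * (a n * m) + (m * n + n * m + m * n)
      <⟨ +-monoʳ-< (4 * d * (a n * m)) (m<m+n _ (*-mono-≤ 1≤m 1≤n)) ⟩
    4 * d * (a n * m) + (m * n + n * m + m * n + m * n)      ≡⟨ lemma d (a n) m n ⟩
    4 * (d * (a n * m) + m * n)                              ∎)
    where
    lemma : ∀ d a m n → 4 * d * (a * m) + (m * n + n * m + m * n + m * n) ≡ 4 * (d * (a * m) + m * n)
    lemma = solve-∀

module _ {P : ℕ → Set} (P? : ∀ n → Dec (P n)) where
  private
    -- `ratio` is reduced to lowest terms; the unnormalised fraction keeps the count and the length
    -- visible.
    rᵘ : ℕ → ℚᵘ
    rᵘ m = mkℚᵘ (+ count P? (suc m)) m

    ratioᵘ : ∀ m → ℚ.toℚᵘ (ratio P? m) ℚᵘ.≃ rᵘ m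
    ratioᵘ m = ℚP.toℚᵘ-fromℚᵘ (rᵘ m)

    ratio-difference : ∀ m n → ℚ.toℚᵘ (ratio P? m ℚ.- ratio P? n) ℚᵘ.≃ rᵘ m ℚᵘ.- rᵘ n
    ratio-difference m n = ℚᵘP.≃-trans (ℚP.toℚᵘ-homo-+ (ratio P? m) (ℚ.- ratio P? n))
      (ℚᵘP.+-cong (ratioᵘ m) (ℚᵘP.≃-trans (ℚP.toℚᵘ-homo‿- (ratio P? n)) (ℚᵘP.-‿cong (ratioᵘ n))))

  -- A positive rational with denominator d is at least 1 / d, so a difference below 1 / d is
  -- enough.
  ratio-< : ∀ m n ε → 0ℚ ℚ.< ε →
    let d = ℚ.↧ₙ ε in d * (count P? (suc m) * suc n) < d * (count P? (suc n) * suc m) + suc m * suc n →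
    ratio P? m ℚ.- ratio P? n ℚ.< ε
  ratio-< m n ε@(mkℚ (+ zero) d-1 _) (ℚ.*<* (ℤ.+<+ ())) cross
  ratio-< m n ε@(mkℚ (ℤ.-[1+ _ ]) d-1 _) (ℚ.*<* ()) cross
  ratio-< m n ε@(mkℚ (+ suc e) d-1 _) 0<ε cross =
    ℚP.toℚᵘ-cancel-< (ℚᵘP.<-respˡ-≃ (ℚᵘP.≃-sym (ratio-difference m n)) (ℚᵘ.*<* (begin-strict
      (+ aₘ ℤ.* + suc n ℤ.+ (ℤ.- + aₙ) ℤ.* + suc m) ℤ.* + den
        ≡⟨ expand (+ aₘ) (+ aₙ) (+ suc m) (+ suc n) (+ den) ⟩
      + den ℤ.* (+ aₘ ℤ.* + suc n) ℤ.- + den ℤ.* (+ aₙ ℤ.* + suc m)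
        ≡⟨ cong₂ ℤ._-_ (cast aₘ (suc n)) (cast aₙ (suc m)) ⟩
      + (den * (aₘ * suc n)) ℤ.- + (den * (aₙ * suc m))
        <⟨ ℤP.+-monoˡ-< (ℤ.- + (den * (aₙ * suc m))) (ℤ.+<+ cross) ⟩
      + (den * (aₙ * suc m) + suc m * suc n) ℤ.- + (den * (aₙ * suc m))
        ≡⟨ trans (cong (ℤ._- + (den * (aₙ * suc m))) (ℤP.pos-+ (den * (aₙ * suc m)) (suc m * suc n))) (cancel (+ (den * (aₙ * suc m))) (+ (suc m * suc n))) ⟩
      + (suc m * suc n)
        ≤⟨ ℤ.+≤+ (m≤n*m (suc m * suc n) (suc e)) ⟩
      + (suc e * (suc m * suc n))
        ≡⟨ ℤP.pos-* (suc e) (suc m * suc n) ⟩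
      + suc e ℤ.* + (suc m * suc n) ∎)))
    where
    open ℤP.≤-Reasoning
    aₘ = count P? (suc m)
    aₙ = count P? (suc n)
    den = suc d-1
    cast : ∀ x y → + den ℤ.* (+ x ℤ.* + y) ≡ + (den * (x * y))
    cast x y = trans (cong (+ den ℤ.*_) (sym (ℤP.pos-* x y))) (sym (ℤP.pos-* den (x * y)))
    expand : ∀ a b m n d → (a ℤ.* n ℤ.+ (ℤ.- b) ℤ.* m) ℤ.* d ≡ d ℤ.* (a ℤ.* n) ℤ.- d ℤ.* (b ℤ.* m)
    expand = ℤSolver.solve-∀
    cancel : ∀ x y → (x ℤ.+ y) ℤ.- x ≡ y
    cancel = ℤSolver.solve-∀

  ratio-cauchy : CrossCauchy (count P?) → ∀ ε → 0ℚ ℚ.< ε →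
    ∃[ M ] ∀ m n → M ≤ m → M ≤ n → ℚ.∣ ratio P? m ℚ.- ratio P? n ∣ ℚ.< ε
  ratio-cauchy cauchy ε 0<ε with cauchy (ℚ.↧ₙ ε)
  ... | M , cross = M , λ m n M≤m M≤n → ∣∣< m n (close m n M≤m M≤n) (close n m M≤n M≤m)
    where
    close : ∀ m n → M ≤ m → M ≤ n → ratio P? m ℚ.- ratio P? n ℚ.< ε
    close m n M≤m M≤n = ratio-< m n ε 0<ε
      (cross (suc m) (suc n) (m≤n⇒m≤1+n M≤m) (m≤n⇒m≤1+n M≤n) (s≤s z≤n) (s≤s z≤n))
    neg-diff : ∀ x y → ℚ.- (x ℚ.- y) ≡ y ℚ.- x
    neg-diff x y = trans (ℚP.neg-distrib-+ x (ℚ.- y))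
      (trans (ℚP.+-comm (ℚ.- x) _) (cong (ℚ._- x) (neg-involutive y)))
      where
      neg-involutive : ∀ y → ℚ.- (ℚ.- y) ≡ y
      neg-involutive (mkℚ (+ zero)     _ _) = refl
      neg-involutive (mkℚ (+ suc _)    _ _) = refl
      neg-involutive (mkℚ ℤ.-[1+ _ ]   _ _) = refl
    ∣∣< : ∀ m n → ratio P? m ℚ.- ratio P? n ℚ.< ε → ratio P? n ℚ.- ratio P? m ℚ.< ε → ℚ.∣ ratio P? m ℚ.- ratio P? n ∣ ℚ.< ε
    ∣∣< m n x<ε -x<ε with ℚP.∣p∣≡p∨∣p∣≡-p (ratio P? m ℚ.- ratio P? n)
    ... | inj₁ eq = subst (ℚ._< ε) (sym eq) x<ε
    ... | inj₂ eq = subst (ℚ._< ε) (sym (trans eq (neg-diff (ratio P? m) (ratio P? n)))) -x<ε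

  ratio-lowerBound : ∀ D .{{_ : NonZero D}} M → (∀ N → M ≤ N → N ≤ D * count P? N) →
    ∃[ δ ] (0ℚ ℚ.< δ × ∃[ M ] ∀ n → M ≤ n → δ ℚ.≤ ratio P? n)
  ratio-lowerBound (suc D) M bound = ℚ.fromℚᵘ δ , positive , M , λ n M≤n →
    ℚP.toℚᵘ-cancel-≤ (ℚᵘP.≤-respˡ-≃ (ℚᵘP.≃-sym (ℚP.toℚᵘ-fromℚᵘ δ)) (ℚᵘP.≤-respʳ-≃ (ℚᵘP.≃-sym (ratioᵘ n)) (ℚᵘ.*≤* (below n M≤n))))
    where
    δ = mkℚᵘ (+ 1) D
    positive : 0ℚ ℚ.< ℚ.fromℚᵘ δ
    positive = ℚP.toℚᵘ-cancel-< (ℚᵘP.<-respʳ-≃ (ℚᵘP.≃-sym (ℚP.toℚᵘ-fromℚᵘ δ)) (ℚᵘ.*<* (ℤ.+<+ (s≤s z≤n))))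
    below : ∀ n → M ≤ n → + 1 ℤ.* + suc n ℤ.≤ + count P? (suc n) ℤ.* + suc D
    below n M≤n = subst₂ ℤ._≤_ (sym (ℤP.*-identityˡ (+ suc n)))
      (trans (cong +_ (*-comm (suc D) _)) (ℤP.pos-* (count P? (suc n)) (suc D)))
      (ℤ.+≤+ (bound (suc n) (m≤n⇒m≤1+n M≤n)))

-- Density of 𝔑_Q

prime⇒coprime-pred : ∀ {r} → Prime (suc r) → Coprime (suc r) r
prime⇒coprime-pred {r} pr = prime∤⇒coprime pr (ℕD.>⇒∤ {{>-nonZero (s≤s⁻¹ (prime>1 pr))}} ≤-refl)

∣-gap : ∀ {x y} → d ∣ x → d ∣ y → x < y → x + d ≤ y
∣-gap {d} {x} {y} d∣x d∣y x<y = begin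
  x + d          ≤⟨ +-monoʳ-≤ x (ℕD.∣⇒≤ {{>-nonZero (m<n⇒0<n∸m x<y)}} (ℕD.∣m+n∣m⇒∣n (subst (d ∣_) (sym (m+[n∸m]≡n (<⇒≤ x<y))) d∣y) d∣x)) ⟩
  x + (y ∸ x)    ≡⟨ m+[n∸m]≡n (<⇒≤ x<y) ⟩
  y              ∎
  where open ≤-Reasoning

≤⇒∣! : ∀ {m n} → 1 ≤ m → m ≤ n → m ∣ n !
≤⇒∣! {suc m} _ m≤n = ℕD.∣-trans (ℕD.m∣m*n (m !)) (ℕD.m≤n⇒m!∣n! m≤n)

module _ (Q : ℕ) where
  Local? : ∀ n q → Dec (Local Q n q)
  Local? n q = prime? q →-dec
    ((q ℕD.∣? Q →-dec (q ∸ 1) ℕD.∣? Q * n) ×-dec (q ℕD.∣? n →-dec ((q ∸ 1) ℕD.∣? Q * n →-dec q ℕD.∣? Q)))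

  private
    ∣-shift : ∀ {q x} n → q ∣ x → (q ∣ n → q ∣ x + n) × (q ∣ x + n → q ∣ n)
    ∣-shift n q∣x = ℕD.∣m∣n⇒∣m+n q∣x , λ q∣x+n → ℕD.∣m+n∣m⇒∣n q∣x+n q∣x

    Q∣-shift : ∀ {q x} n → q ∣ x → (q ∣ Q * n → q ∣ Q * (x + n)) × (q ∣ Q * (x + n) → q ∣ Q * n)
    Q∣-shift {q} {x} n q∣x =
      let to , from = ∣-shift (Q * n) (ℕD.∣n⇒∣m*n Q q∣x)
      in (λ q∣ → subst (q ∣_) (sym (*-distribˡ-+ Q x n)) (to q∣)) , (λ q∣ → from (subst (q ∣_) (*-distribˡ-+ Q x n) q∣))

  Local-shift : ∀ {q x} n → q ∣ x → q ∸ 1 ∣ x → (Local Q n q → Local Q (x + n) q) × (Local Q (x + n) q → Local Q n q)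
  Local-shift n q∣x q-1∣x =
    let to , from = ∣-shift n q∣x
        toQ , fromQ = Q∣-shift n q-1∣x
    in (λ local pr → toQ ∘ proj₁ (local pr) , λ q∣ q-1∣ → proj₂ (local pr) (from q∣) (fromQ q-1∣)) ,
       (λ local pr → fromQ ∘ proj₁ (local pr) , λ q∣ q-1∣ → proj₂ (local pr) (to q∣) (toQ q-1∣))

  LocalUpTo : ℕ → ℕ → Set
  LocalUpTo T n = ∀ {q} → q < suc T → Local Q n q

  LocalUpTo? : ∀ T n → Dec (LocalUpTo T n)
  LocalUpTo? T n = allUpTo? (Local? n) (suc T)

  LocalUpTo-shift : ∀ T {x} n → T ! ∣ x → (LocalUpTo T n → LocalUpTo T (x + n)) × (LocalUpTo T (x + n) → LocalUpTo T n)
  LocalUpTo-shift T {x} n T!∣x =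
    (λ local q≤T pr → proj₁ (Local-shift n (q∣x q≤T pr) (q-1∣x q≤T pr)) (local q≤T) pr) ,
    (λ local q≤T pr → proj₂ (Local-shift n (q∣x q≤T pr) (q-1∣x q≤T pr)) (local q≤T) pr)
    where
    q∣x : ∀ {q} → q < suc T → Prime q → q ∣ x
    q∣x q≤T pr = ℕD.∣-trans (≤⇒∣! (<⇒≤ (prime>1 pr)) (s≤s⁻¹ q≤T)) T!∣x
    q-1∣x : ∀ {q} → q < suc T → Prime q → q ∸ 1 ∣ x
    q-1∣x {q} q≤T pr = ℕD.∣-trans (≤⇒∣! (m<n⇒0<n∸m (prime>1 pr)) (≤-trans (m∸n≤m q 1) (s≤s⁻¹ q≤T))) T!∣x

  -- The prime is suc r, so that r is its predecessor.
  Bad : ℕ → ℕ → Set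
  Bad r n = Prime (suc r) × suc r ∣ n × r ∣ Q * n

  Bad? : ∀ r n → Dec (Bad r n)
  Bad? r n = prime? (suc r) ×-dec ((suc r ℕD.∣? n) ×-dec (r ℕD.∣? Q * n))

  Bad⇒∣ : ∀ {r n} → Bad r n → suc r * r ∣ Q * n
  Bad⇒∣ {r} (pr , q∣n , q-1∣Qn) = coprime-*-∣ (suc r) r (prime⇒coprime-pred pr) (ℕD.∣n⇒∣m*n Q q∣n) q-1∣Qn

module _ {Q} (ppn : WeakPPN Q) where
  private instance
    Q≢0 : NonZero Q
    Q≢0 = >-nonZero (proj₁ ppn)

  -- A prime above T ≥ Q does not divide Q, so it can violate only the second half of `Local`. It
  -- then divides n, which bounds it by R and makes the search for it finite.
  LocalUpTo⇒InN⊎Bad : ∀ {T n} R → Q ≤ T → 1 ≤ n → n ≤ R → LocalUpTo Q T n →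
    InN Q n ⊎ (∃[ i ] i < R × Bad Q (T + i) n)
  LocalUpTo⇒InN⊎Bad {T} {n} R Q≤T 1≤n n≤R local with anyUpTo? (λ i → Bad? Q (T + i) n) R
  ... | yes bad = inj₂ bad
  ... | no ¬bad = inj₁ (Local⇒InN ppn 1≤n everywhere)
    where
    everywhere : ∀ q → Local Q n q
    everywhere q with q ≤? T
    ... | yes q≤T = local (s≤s q≤T)
    ... | no q≰T = λ pr → (λ q∣Q → ⊥-elim (q≰T (≤-trans (ℕD.∣⇒≤ q∣Q) Q≤T))) ,
      λ q∣n q-1∣Qn → ⊥-elim (¬bad (q ∸ suc T , i<R q∣n , subst (λ r → Prime r × r ∣ n × r ∸ 1 ∣ Q * n) q≡ (pr , q∣n , q-1∣Qn)))
      where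
      q≡ : q ≡ suc (T + (q ∸ suc T))
      q≡ = sym (m+[n∸m]≡n (≰⇒> q≰T))
      i<R : q ∣ n → q ∸ suc T < R
      i<R q∣n = <-≤-trans (∸-monoʳ-< {q} {suc T} {0} (s≤s z≤n) (≰⇒> q≰T)) (≤-trans (ℕD.∣⇒≤ {{>-nonZero 1≤n}} q∣n) n≤R)

  count-Bad : ∀ r N → count (Bad? Q r) N * (suc r * r) ≤ Q * N
  count-Bad r N = count-separated (Bad? Q r) (suc r * r) (Q *_) (*-monoʳ-≤ Q)
    (λ i 1≤i bad → ℕD.∣⇒≤ {{m*n≢0 Q i {{Q≢0}} {{>-nonZero 1≤i}}}} (Bad⇒∣ Q bad))
    (λ i j _ i<j badᵢ badⱼ → ∣-gap (Bad⇒∣ Q badᵢ) (Bad⇒∣ Q badⱼ) (*-monoʳ-< Q i<j)) N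

  InN-periodicApproximable : PeriodicApproximable (count (InN? Q)) Q
  InN-periodicApproximable T Q≤T = W , count (LocalUpTo? Q T) W , >-nonZero⁻¹ W {{T!≢0}} , λ N → upper N , lower N
    where
    open ≤-Reasoning
    W = T !
    instance
      T≢0 : NonZero T
      T≢0 = >-nonZero (≤-trans (proj₁ ppn) Q≤T)
      T!≢0 : NonZero W
      T!≢0 = T !≢0
    inN upTo bad : ℕ → ℕ
    inN = count (InN? Q)
    upTo = count (LocalUpTo? Q T)
    bad N = ∑ (λ i → count (Bad? Q (T + i)) N) N
    periodic : ∀ n → (LocalUpTo Q T n → LocalUpTo Q T (W + n)) × (LocalUpTo Q T (W + n) → LocalUpTo Q T n)
    periodic n = LocalUpTo-shift Q T n ℕD.∣-refl
    inN≤upTo : ∀ N → inN N ≤ upTo N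
    -- With an empty family the union bound becomes monotonicity of `count`.
    inN≤upTo N = subst (inN N ≤_) (+-identityʳ (upTo N)) (count-∪ {C = λ _ _ → ⊥} (InN? Q) (LocalUpTo? Q T) (λ _ _ → no λ ()) 0 N
      (λ n 1≤n _ inN → inj₁ (λ _ → InN⇒Local ppn 1≤n inN _)))
    upTo≤inN+bad : ∀ N → upTo N ≤ inN N + bad N
    upTo≤inN+bad N = count-∪ (LocalUpTo? Q T) (InN? Q) (λ i → Bad? Q (T + i)) N N
      (λ n 1≤n n≤N → LocalUpTo⇒InN⊎Bad N Q≤T 1≤n n≤N)
    Tbad≤QN : ∀ N → T * bad N ≤ Q * N
    Tbad≤QN N = telescope T (λ i → count (Bad? Q (T + i)) N) N (λ i _ → count-Bad (T + i) N)
    upper : ∀ N → W * inN N ≤ N * upTo W + W * W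
    upper N = ≤-trans (*-monoʳ-≤ W (inN≤upTo N)) (count-periodic-≤ (LocalUpTo? Q T) W periodic N)
    lower : ∀ N → T * (N * upTo W) ≤ T * (W * inN N + W * W) + W * (Q * N)
    lower N = begin
      T * (N * upTo W)                            ≤⟨ *-monoʳ-≤ T (count-periodic-≥ (LocalUpTo? Q T) W periodic N) ⟩
      T * (W * upTo N + W * W)                    ≤⟨ *-monoʳ-≤ T (+-monoˡ-≤ (W * W) (*-monoʳ-≤ W (upTo≤inN+bad N))) ⟩
      T * (W * (inN N + bad N) + W * W)            ≡⟨ lemma T W (inN N) (bad N) ⟩
      T * (W * inN N + W * W) + W * (T * bad N)    ≤⟨ +-monoʳ-≤ (T * (W * inN N + W * W)) (*-monoʳ-≤ W (Tbad≤QN N)) ⟩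
      T * (W * inN N + W * W) + W * (Q * N)      ∎
      where
      lemma : ∀ T W a c → T * (W * (a + c) + W * W) ≡ T * (W * a + W * W) + W * (T * c)
      lemma = solve-∀

  -- Positivity along a progression through `n₀`

  module _ {n₀} (n₀∈N : InN Q n₀) where
    private
      instance
        n₀≢0 : NonZero n₀
        n₀≢0 = >-nonZero (proj₁ n₀∈N)
      X = Q * n₀
      -- Chosen so that the telescoped bound X J / T is J / 4; also T ≥ Q.
      T = 4 * X
      M = T !
      -- Chosen so that Q * g J, which is at most 2 X M J, is at most T′ J / 4.
      T′ = 8 * (X * M)
      instance
        X≢0 : NonZero X
        X≢0 = m*n≢0 Q n₀
        T≢0 : NonZero T
        T≢0 = m*n≢0 4 X
        M≢0 : NonZero M
        M≢0 = T !≢0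
        T+T′≢0 : NonZero (T + T′)
        T+T′≢0 = >-nonZero (<-≤-trans (>-nonZero⁻¹ T) (m≤m+n T T′))

      g : ℕ → ℕ
      g j = n₀ * (M * j + 1)

      Qg : ∀ j → Q * g j ≡ X * (M * j + 1)
      Qg j = sym (*-assoc Q n₀ _)

      g-mono-< : ∀ {i j} → i < j → g i < g j
      g-mono-< i<j = *-monoʳ-< n₀ (+-monoˡ-< 1 (*-monoʳ-< M i<j))

      g-mono-≤ : ∀ {i j} → i ≤ j → g i ≤ g j
      g-mono-≤ i≤j = *-monoʳ-≤ n₀ (+-monoˡ-≤ 1 (*-monoʳ-≤ M i≤j))

      1≤g : ∀ j → 1 ≤ g j
      1≤g j = *-mono-≤ (proj₁ n₀∈N) (m≤n+m 1 (M * j))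

      g-local : ∀ j → LocalUpTo Q T (g j)
      g-local j = subst (LocalUpTo Q T) (lemma n₀ M j)
        (proj₁ (LocalUpTo-shift Q T n₀ (ℕD.∣n⇒∣m*n n₀ (ℕD.m∣m*n j))) (λ _ → InN⇒Local ppn (proj₁ n₀∈N) n₀∈N _))
        where
        lemma : ∀ n M j → n * (M * j) + n ≡ n * (M * j + 1)
        lemma = solve-∀

      -- D = q (q - 1) divides X (M i + 1) and, by subtraction, X M k. Since k X (M i + 1) - i X M k
      -- = X k, it divides X k: the factor M is gone because M i + 1 is prime to M.
      Bad-spacing : ∀ {r} i k → 1 ≤ k → Bad Q r (g i) → Bad Q r (g (i + k)) → suc r * r ≤ X * k
      Bad-spacing {r} i k 1≤k badᵢ badⱼ = ℕD.∣⇒≤ {{m*n≢0 X k {{X≢0}} {{>-nonZero 1≤k}}}}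
        (ℕD.∣m+n∣m⇒∣n (subst (D ∣_) (lemma₂ X M i k) (ℕD.∣m⇒∣m*n k D∣ᵢ)) (ℕD.∣m⇒∣m*n i D∣XMk))
        where
        D = suc r * r
        D∣ᵢ : D ∣ X * (M * i + 1)
        D∣ᵢ = subst (D ∣_) (Qg i) (Bad⇒∣ Q badᵢ)
        lemma₁ : ∀ X M i k → X * (M * (i + k) + 1) ≡ X * (M * i + 1) + X * M * k
        lemma₁ = solve-∀
        lemma₂ : ∀ X M i k → X * (M * i + 1) * k ≡ X * M * k * i + X * k
        lemma₂ = solve-∀
        D∣XMk : D ∣ X * M * k
        D∣XMk = ℕD.∣m+n∣m⇒∣n (subst (D ∣_) (trans (Qg (i + k)) (lemma₁ X M i k)) (Bad⇒∣ Q badⱼ)) D∣ᵢ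

      badCount : ℕ → ℕ → ℕ
      badCount J r = count (λ j → Bad? Q r (g j)) J

      -- The error term of one element per prime is affordable for the primes up to T + T′; beyond them
      -- badCount-multiples, which loses a factor M but has no error term, takes over.
      badCount-progression : ∀ J r → badCount J r * (suc r * r) ≤ X * J + suc r * r
      -- Spacing says nothing about the first bad index, so the weight starts at D to pay for it.
      badCount-progression J r = count-separated (λ j → Bad? Q r (g j)) D (λ j → X * j + D)
        (λ i≤j → +-monoˡ-≤ D (*-monoʳ-≤ X i≤j)) (λ i _ _ → m≤n+m D (X * i)) next J
        where
        open ≤-Reasoning
        D = suc r * r
        next : ∀ i j → 1 ≤ i → i < j → Bad Q r (g i) → Bad Q r (g j) → X * i + D + D ≤ X * j + D
        next i j _ i<j badᵢ badⱼ = +-monoˡ-≤ D (begin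
          X * i + D             ≤⟨ +-monoʳ-≤ (X * i) (Bad-spacing i (j ∸ i) (m<n⇒0<n∸m i<j) badᵢ (subst (Bad Q r ∘ g) (sym i+[j-i]≡j) badⱼ)) ⟩
          X * i + X * (j ∸ i)   ≡⟨ sym (*-distribˡ-+ X i (j ∸ i)) ⟩
          X * (i + (j ∸ i))     ≡⟨ cong (X *_) i+[j-i]≡j ⟩
          X * j                 ∎)
          where
          i+[j-i]≡j : i + (j ∸ i) ≡ j
          i+[j-i]≡j = m+[n∸m]≡n (<⇒≤ i<j)

      badCount-multiples : ∀ J r → badCount J r * (suc r * r) ≤ Q * g J
      badCount-multiples J r = count-separated (λ j → Bad? Q r (g j)) (suc r * r) (λ j → Q * g j)
        (λ i≤j → *-monoʳ-≤ Q (g-mono-≤ i≤j))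
        (λ i _ bad → ℕD.∣⇒≤ {{m*n≢0 Q (g i) {{Q≢0}} {{>-nonZero (1≤g i)}}}} (Bad⇒∣ Q bad))
        (λ i j _ i<j badᵢ badⱼ → ∣-gap (Bad⇒∣ Q badᵢ) (Bad⇒∣ Q badⱼ) (*-monoʳ-< Q (g-mono-< i<j))) J

      module _ (J : ℕ) (1≤J : 1 ≤ J) where
        open ≤-Reasoning

        MJ+1≤2MJ : M * J + 1 ≤ 2 * (M * J)
        MJ+1≤2MJ = begin
          M * J + 1            ≤⟨ +-monoʳ-≤ (M * J) (*-mono-≤ (>-nonZero⁻¹ M) 1≤J) ⟩
          M * J + M * J        ≡⟨ cong (λ z → M * J + z) (sym (+-identityʳ (M * J))) ⟩
          2 * (M * J)          ∎

        -- Removing one index per prime by `pred` cancels the error term D, which makes the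
        -- telescoping bound applicable.
        middle : 4 * ∑ (λ i → pred (badCount J (T + i))) T′ ≤ J
        middle = *-cancelˡ-≤ X (begin
          X * (4 * s)  ≡⟨ lemma X s ⟩
          T * s        ≤⟨ telescope T (λ i → pred (badCount J (T + i))) T′ (λ i _ → bound (T + i)) ⟩
          X * J        ∎)
          where
          s = ∑ (λ i → pred (badCount J (T + i))) T′
          lemma : ∀ X s → X * (4 * s) ≡ 4 * X * s
          lemma = solve-∀
          bound : ∀ r → pred (badCount J r) * (suc r * r) ≤ X * J
          bound r with badCount J r | badCount-progression J r
          ... | zero  | _     = z≤n
          ... | suc c | c+1≤  = +-cancelˡ-≤ (suc r * r) _ _ (subst (suc c * (suc r * r) ≤_) (+-comm (X * J) _) c+1≤)

        -- Telescoping from T + T′ ≥ T′ bounds the sum by X (M J + 1) / T′, at most 2 X M J / (8 X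
        -- M) = J / 4.
        tail : 4 * ∑ (λ i → badCount J (T + (T′ + i))) (g J) ≤ J
        tail = *-cancelˡ-≤ (2 * (X * M)) {{m*n≢0 2 (X * M) {{_}} {{m*n≢0 X M}}}} (begin
          2 * (X * M) * (4 * s)    ≡⟨ lemma₁ (X * M) s ⟩
          T′ * s                   ≤⟨ *-monoˡ-≤ s (m≤n+m T′ T) ⟩
          (T + T′) * s             ≤⟨ telescope (T + T′) (λ i → badCount J (T + (T′ + i))) (g J) (λ i _ → bound i) ⟩
          Q * g J                  ≡⟨ Qg J ⟩
          X * (M * J + 1)          ≤⟨ *-monoʳ-≤ X MJ+1≤2MJ ⟩
          X * (2 * (M * J))        ≡⟨ lemma₂ X M J ⟩
          2 * (X * M) * J          ∎)
          where
          s = ∑ (λ i → badCount J (T + (T′ + i))) (g J)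
          lemma₁ : ∀ y s → 2 * y * (4 * s) ≡ 8 * y * s
          lemma₁ = solve-∀
          lemma₂ : ∀ X M J → X * (2 * (M * J)) ≡ 2 * (X * M) * J
          lemma₂ = solve-∀
          bound : ∀ i → badCount J (T + (T′ + i)) * (suc (T + T′ + i) * (T + T′ + i)) ≤ Q * g J
          bound i = subst (λ r → badCount J (T + (T′ + i)) * (suc r * r) ≤ Q * g J) (sym (+-assoc T T′ i))
            (badCount-multiples J (T + (T′ + i)))

        -- The indices lost to `middle`, to the T′ single ones set aside there and to `tail` are at
        -- most J / 4 each, so a quarter of the J indices survives.
        progression-count : 4 * T′ ≤ J → J ≤ 4 * count (InN? Q) (g J)
        progression-count 4T′≤J = +-cancelʳ-≤ (3 * J) _ _ (begin
          4 * J                                          ≡⟨ cong (4 *_) (sym (count-⊤ J)) ⟩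
          4 * count {λ _ → ⊤} (λ _ → yes tt) J           ≤⟨ *-monoʳ-≤ 4 covered ⟩
          4 * (G + ∑ bad (T′ + g J))                     ≡⟨ cong (λ z → 4 * (G + z)) (∑-split bad T′ (g J)) ⟩
          4 * (G + (∑ bad T′ + u))                       ≤⟨ *-monoʳ-≤ 4 (+-monoʳ-≤ G (+-monoˡ-≤ u (∑≤∑pred+k bad T′))) ⟩
          4 * (G + (s + T′ + u))                         ≡⟨ lemma₁ G s T′ u ⟩
          4 * G + (4 * s + 4 * T′ + 4 * u)               ≤⟨ +-monoʳ-≤ (4 * G) (+-mono-≤ (+-mono-≤ middle 4T′≤J) tail) ⟩
          4 * G + (J + J + J)                            ≡⟨ cong (λ z → 4 * G + z) (lemma₂ J) ⟩
          4 * G + 3 * J                                  ≤⟨ +-monoˡ-≤ (3 * J) (*-monoʳ-≤ 4 (count-∘ (InN? Q) g (λ j → g-mono-< (n<1+n j)) J)) ⟩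
          4 * count (InN? Q) (g J) + 3 * J               ∎)
          where
          G = count (λ j → InN? Q (g j)) J
          bad : ℕ → ℕ
          bad i = badCount J (T + i)
          s = ∑ (λ i → pred (bad i)) T′
          u = ∑ (λ i → bad (T′ + i)) (g J)
          covered : count {λ _ → ⊤} (λ _ → yes tt) J ≤ G + ∑ bad (T′ + g J)
          covered = count-∪ (λ _ → yes tt) (λ j → InN? Q (g j)) (λ i j → Bad? Q (T + i) (g j)) (T′ + g J) J
            (λ j _ j≤J _ → LocalUpTo⇒InN⊎Bad (T′ + g J) Q≤T (1≤g j) (≤-trans (g-mono-≤ j≤J) (m≤n+m (g J) T′)) (g-local j))
            where
            Q≤T : Q ≤ T
            Q≤T = ≤-trans (m≤m*n Q n₀) (m≤n*m X 4)
          lemma₁ : ∀ G s t u → 4 * (G + (s + t + u)) ≡ 4 * G + (4 * s + 4 * t + 4 * u)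
          lemma₁ = solve-∀
          lemma₂ : ∀ J → J + J + J ≡ 3 * J
          lemma₂ = solve-∀

    InN-linear : ∃₂ λ D N₀ → NonZero D × (∀ N → N₀ ≤ N → N ≤ D * count (InN? Q) N)
    InN-linear = 8 * E , 4 * T′ * E , m*n≢0 8 E , bound
      where
      open ≤-Reasoning
      -- g J ≤ J E, so the progression up to index J = N / E stays below N. From N ≤ 2 E J and the
      -- surviving quarter of J comes the factor 8 E.
      E = 2 * (n₀ * M)
      instance
        E≢0 : NonZero E
        E≢0 = m*n≢0 2 (n₀ * M) {{_}} {{m*n≢0 n₀ M}}
        T′≢0 : NonZero T′
        T′≢0 = m*n≢0 8 (X * M) {{_}} {{m*n≢0 X M}}
      bound : ∀ N → 4 * T′ * E ≤ N → N ≤ 8 * E * count (InN? Q) N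
      bound N N₀≤N = begin
        N                                          ≡⟨ m≡m%n+[m/n]*n N E ⟩
        N % E + J * E                              ≤⟨ +-monoˡ-≤ (J * E) (≤-trans (m%n≤n N E) (m≤n*m E J {{>-nonZero 1≤J}})) ⟩
        J * E + J * E                              ≡⟨ lemma₁ J E ⟩
        2 * E * J                                  ≤⟨ *-monoʳ-≤ (2 * E) (progression-count J 1≤J 4T′≤J) ⟩
        2 * E * (4 * count (InN? Q) (g J))         ≡⟨ lemma₂ E _ ⟩
        8 * E * count (InN? Q) (g J)               ≤⟨ *-monoʳ-≤ (8 * E) (count-mono (InN? Q) gJ≤N) ⟩
        8 * E * count (InN? Q) N                   ∎
        where
        J = N / E
        4T′≤J : 4 * T′ ≤ J
        4T′≤J = subst (_≤ J) (m*n/n≡m (4 * T′) E) (/-monoˡ-≤ E N₀≤N)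
        1≤J : 1 ≤ J
        1≤J = ≤-trans (>-nonZero⁻¹ (4 * T′) {{m*n≢0 4 T′}}) 4T′≤J
        gJ≤N : g J ≤ N
        gJ≤N = begin
          n₀ * (M * J + 1)    ≤⟨ *-monoʳ-≤ n₀ (MJ+1≤2MJ J 1≤J) ⟩
          n₀ * (2 * (M * J))  ≡⟨ lemma₃ n₀ M J ⟩
          J * E               ≤⟨ m/n*n≤m N E ⟩
          N                   ∎
          where
          lemma₃ : ∀ n M J → n * (2 * (M * J)) ≡ J * (2 * (n * M))
          lemma₃ = solve-∀
        lemma₁ : ∀ J E → J * E + J * E ≡ 2 * E * J
        lemma₁ = solve-∀
        lemma₂ : ∀ E a → 2 * E * (4 * a) ≡ 8 * E * a
        lemma₂ = solve-∀

theorem3 : (Q : ℕ) → WeakPPN Q → ∃[ n ] InN Q n → HasPositiveDensity (InN? Q)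
theorem3 Q ppn (n₀ , n₀∈N) =
  ratio-cauchy (InN? Q) (periodicApproximable⇒cauchy (count (InN? Q)) Q {{>-nonZero (proj₁ ppn)}} (InN-periodicApproximable ppn)) ,
  (let D , N₀ , D≢0 , bound = InN-linear ppn n₀∈N
   in ratio-lowerBound (InN? Q) D {{D≢0}} N₀ bound)
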